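{- Let $(P,\rho,\bar\zeta)$ be a quasi-graded poset with minimal element $\hat0$ and maximal element $\hat1$. Assume that $P$ has a zipper $x,y,z$ with $z\neq\hat0$, and let $(Q,\rho_Q,\bar\zeta_Q)$ be the zipped quasi-graded poset, with new element $w$. Then the $\mathbf{ab}$-indexes of $Q$ and of the interval $[\hat0,w]$ of $Q$ are given by $$\Psi(Q)=\Psi(P)-\Psi([\hat0,z])\cdot\mathbf d\cdot\Psi([x,\hat1]),$$ $$\Psi([\hat0,w])=\Psi([\hat0,x])+\Psi([\hat0,y])-\Psi([\hat0,z])\cdot\mathbf c,$$ where $\mathbf c=\mathbf a+\mathbf b$, $\mathbf d=\mathbf a\mathbf b+\mathbf b\mathbf a$, and all intervals on the right-hand sides are taken in $P$.
   Context: A quasi-graded poset $(P,\rho,\bar\zeta)$ consists of a finite poset $P$, a function $\rho:P\to\mathbb N$ with $x<y\Rightarrow\rho(x)<\rho(y)$, and a complex-valued function $\bar\zeta$ in the incidence algebra of $P$ with $\bar\zeta(x,x)=1$ for all $x$; set $\bar\zeta(u,v)=0$ if $u\not\le v$. Write $\rho(x,y)=\rho(y)-\rho(x)$. Intervals are quasi-graded posets by restriction. For a quasi-graded poset with minimal element $\hat0$ and maximal element $\hat1$, $\hat0<\hat1$, the $\mathbf{ab}$-index is the polynomial in non-commuting variables $\mathbf a,\mathbf b$ $$\Psi(P)=\sum_{c}\bar\zeta(x_0,x_1)\cdots\bar\zeta(x_{k-1},x_k)\cdot(\mathbf a-\mathbf b)^{\rho(x_0,x_1)-1}\,\mathbf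 b\,(\mathbf a-\mathbf b)^{\rho(x_1,x_2)-1}\,\mathbf b\cdots\mathbf b\,(\mathbf a-\mathbf b)^{\rho(x_{k-1},x_k)-1},$$ the sum over all chains $c=\{\hat0=x_0<x_1<\cdots<x_k=\hat1\}$, $k\ge1$. A zipper in $(P,\rho,\bar\zeta)$ consists of three distinct elements $x,y,z$ such that (i) $\rho(x)=\rho(y)=\rho(z)+1$; (ii) $z$ is covered by $x$ and $y$ and by no other element; (iii) for all $v>z$ with $\rho(v)>\rho(x)$, $\bar\zeta(x,v)=\bar\zeta(y,v)=\bar\zeta(z,v)$; (iv) $\bar\zeta(z,x)=\bar\zeta(z,y)=1$. The zipped quasi-graded poset is $Q=(P\setminus\{x,y,z\})\cup\{w\}$ with $w$ a new element. $Q$ inherits the order of $P$ together with the relations $u<_Qw$ if $u<_Px$ or $u<_Py$, and $w<_Qv$ if $x<_Pv$ or $y<_Pv$ (and relations implied by transitivity). $\rho_Q$ is inherited from $P$ with $\rho_Q(w)=\rho(x)$. $\bar\zeta_Q$ is inherited from $\bar\zeta$ on pairs not involving $w$, and $\bar\zeta_Q(w,v)=\bar\zeta(x,v)$, $\bar\zeta_Q(u,w)=\bar\zeta(u,x)+\bar\zeta(u,y)-\bar\zeta(u,z)$, $\bar\zeta_Q(w,w)=1$. -}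

module Defs where

open import Level using (Level; _⊔_; suc)
open import Algebra.Bundles using (CommutativeRing)
open import Data.Bool.Base using (if_then_else_)
open import Data.Empty using (⊥-elim)
open import Data.Irrelevant using ([_])
open import Data.List.Base as List
  using (List; []; _∷_; _++_; concatMap; cartesianProductWith; filter; upTo)
open import Data.List.Membership.Propositional using (_∈_)
open import Data.List.Membership.Propositional.Properties
  using (∈-map⁺; ∈-filter⁺; ∈-concatMap⁺; ∈-upTo⁺; ∈-cartesianProductWith⁺)
open import Data.List.Properties using (≡-dec)
open import Data.List.Relation.Unary.All as All using (All; []; _∷_)
import Data.List.Relation.Unary.All.Properties as All
open import Data.List.Relation.Unary.AllPairs using ([]; _∷_)
open import Data.List.Relation.Unary.Any as Any using (here; there)
open import Data.List.Relation.Unary.Linked using (Linked; [-]; _∷_; linked?)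
open import Data.List.Relation.Unary.Unique.Propositional using (Unique)
import Data.List.Relation.Unary.Unique.Propositional.Properties as Unique
open import Data.Maybe.Base using (Maybe; just; nothing)
open import Data.Maybe.Properties using (just-injective)
import Data.Maybe.Properties as Maybe
open import Data.Nat.Base as ℕ using (ℕ; zero; _∸_)
import Data.Nat.Properties as ℕ
open import Data.Product.Base using (_×_; _,_; proj₁; proj₂)
open import Data.Refinement using (Refinement; _,_; value; value-injective)
import Data.Refinement as Refinement
open import Data.Sum.Base using (_⊎_; inj₁; inj₂)
open import Function.Base using (_∘_; case_of_)
open import Relation.Binary.Definitions using (DecidableEquality; Minimum; Maximum; Decidable)
open import Relation.Binary.PropositionalEquality
  using (_≡_; _≢_; refl; sym; cong; isEquivalence)
open import Relation.Binary.Structures using (IsDecPartialOrder)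
import Relation.Binary.Construct.NonStrictToStrict as NonStrictToStrict
open import Relation.Nullary using (¬_; yes; no; does; contradiction)
open import Relation.Nullary.Decidable using (_×-dec_; _⊎-dec_; ¬?; map′; recompute)
open import Relation.Unary using (Pred) renaming (Decidable to Decidable₁)

private
  variable
    c ℓ p q s : Level

------------------------------------------------------------------------
-- Polynomials in the non-commuting variables 𝐚 and 𝐛

data Letter : Set where
  a b : Letter

_≟ᴸ_ : DecidableEquality Letter
a ≟ᴸ a = yes refl
a ≟ᴸ b = no λ ()
b ≟ᴸ a = no λ ()
b ≟ᴸ b = yes refl

Word : Set
Word = List Letter

_≟ᵂ_ : DecidableEquality Word
_≟ᵂ_ = ≡-dec _≟ᴸ_

module NCPolynomial (R : CommutativeRing c ℓ) where

  private module R = CommutativeRing R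

  -- A polynomial is a formal finite sum of terms r·u, in which the same
  -- word may occur repeatedly; the equality of polynomials is _≈_ below.
  Poly : Set c
  Poly = List (R.Carrier × Word)

  coeff : Poly → Word → R.Carrier
  coeff []            w = R.0#
  coeff ((r , u) ∷ f) w = (if does (u ≟ᵂ w) then r else R.0#) R.+ coeff f w

  infix  4 _≈_
  infixl 6 _+_ _-_
  infixl 7 _*_
  infixr 8 _^_

  _≈_ : Poly → Poly → Set ℓ
  f ≈ g = ∀ w → coeff f w R.≈ coeff g w

  _+_ : Poly → Poly → Poly
  _+_ = _++_

  -_ : Poly → Poly
  -_ = List.map λ (r , u) → R.- r , u

  _-_ : Poly → Poly → Poly
  f - g = f + (- g)

  _*_ : Poly → Poly → Poly
  _*_ = cartesianProductWith λ (r , u) (t , v) → r R.* t , u ++ v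

  scalar : R.Carrier → Poly
  scalar r = (r , []) ∷ []

  _^_ : Poly → ℕ → Poly
  f ^ zero    = scalar R.1#
  f ^ ℕ.suc n = f * f ^ n

  𝐚 𝐛 𝐜 𝐝 : Poly
  𝐚 = (R.1# , a ∷ []) ∷ []
  𝐛 = (R.1# , b ∷ []) ∷ []
  𝐜 = 𝐚 + 𝐛
  𝐝 = 𝐚 * 𝐛 + 𝐛 * 𝐚

------------------------------------------------------------------------
-- Quasi-graded posets

-- The ring R of values of ζ̄ is arbitrary; the classical case is R = ℂ.
record QuasiGradedPoset (R : CommutativeRing c ℓ) (p q : Level)
       : Set (c ⊔ ℓ ⊔ suc (p ⊔ q)) where
  private module R = CommutativeRing R
  infix 4 _≤_
  field
    Carrier           : Set p
    _≤_               : Carrier → Carrier → Set q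
    isDecPartialOrder : IsDecPartialOrder _≡_ _≤_

    elements : List Carrier
    unique   : Unique elements
    complete : ∀ u → u ∈ elements

  open IsDecPartialOrder isDecPartialOrder public
    using (_≟_; _≤?_)
    renaming (refl to ≤-refl; trans to ≤-trans; antisym to ≤-antisym)

  open NonStrictToStrict _≡_ _≤_ public using (_<_)

  _<?_ : Decidable _<_
  _<?_ = NonStrictToStrict.<-decidable _≡_ _≤_ _≟_ _≤?_

  field
    ρ        : Carrier → ℕ
    ρ-mono-< : ∀ {u v} → u < v → ρ u ℕ.< ρ v

    ζ̄         : Carrier → Carrier → R.Carrier
    ζ̄-refl    : ∀ u → ζ̄ u u R.≈ R.1#
    ζ̄-support : ∀ {u v} → ¬ (u ≤ v) → ζ̄ u v R.≈ R.0#

  infix 4 _⋖_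
  _⋖_ : Carrier → Carrier → Set (p ⊔ q)
  u ⋖ v = u < v × (∀ t → u < t → ¬ (t < v))

  ≤-<-trans : ∀ {u v w} → u ≤ v → v < w → u < w
  ≤-<-trans u≤v (v≤w , v≢w) =
    ≤-trans u≤v v≤w , λ { refl → v≢w (≤-antisym v≤w u≤v) }

  <-≤-trans : ∀ {u v w} → u < v → v ≤ w → u < w
  <-≤-trans (u≤v , u≢v) v≤w =
    ≤-trans u≤v v≤w , λ { refl → u≢v (≤-antisym u≤v v≤w) }

record BoundedQuasiGradedPoset (R : CommutativeRing c ℓ) (p q : Level)
       : Set (c ⊔ ℓ ⊔ suc (p ⊔ q)) where
  field
    poset : QuasiGradedPoset R p q
  open QuasiGradedPoset poset public
  field
    0̂ 1̂     : Carrier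
    minimum : Minimum _≤_ 0̂
    maximum : Maximum _≤_ 1̂
    0̂<1̂     : 0̂ < 1̂

------------------------------------------------------------------------
-- The 𝐚𝐛-index

module _ {R : CommutativeRing c ℓ} (P : BoundedQuasiGradedPoset R p q) where
  open BoundedQuasiGradedPoset P
  open NCPolynomial R

  -- A chain 0̂ = x₀ < x₁ < ⋯ < xₖ = 1̂ is encoded by the list
  -- x₁ , … , xₖ₋₁ of its interior elements.
  IsChain : List Carrier → Set (p ⊔ q)
  IsChain xs = Linked _<_ (0̂ ∷ xs ++ 1̂ ∷ [])

  isChain? : Decidable₁ IsChain
  isChain? xs = linked? _<?_ (0̂ ∷ xs ++ 1̂ ∷ [])

  listsOfLength : ℕ → List (List Carrier)
  listsOfLength zero      = [] ∷ []
  listsOfLength (ℕ.suc n) = cartesianProductWith _∷_ elements (listsOfLength n)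

  -- As ρ strictly increases along a chain, a chain has fewer than
  -- ρ(0̂,1̂) interior elements (see chains-complete).
  chains : List (List Carrier)
  chains = filter isChain? (concatMap listsOfLength (upTo (ρ 1̂ ∸ ρ 0̂)))

  -- The summand of the chain u < t₁ < ⋯ < tₙ < v with interior t₁ , … , tₙ.
  chainTerm : Carrier → List Carrier → Carrier → Poly
  chainTerm u []       v = scalar (ζ̄ u v) * (𝐚 - 𝐛) ^ (ρ v ∸ ρ u ∸ 1)
  chainTerm u (t ∷ ts) v =
    scalar (ζ̄ u t) * (𝐚 - 𝐛) ^ (ρ t ∸ ρ u ∸ 1) * 𝐛 * chainTerm t ts v

  Ψ : Poly
  Ψ = concatMap (λ xs → chainTerm 0̂ xs 1̂) chains

  private
    ∈-listsOfLength : ∀ xs → xs ∈ listsOfLength (List.length xs)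
    ∈-listsOfLength []       = here refl
    ∈-listsOfLength (x ∷ xs) =
      ∈-cartesianProductWith⁺ _∷_ (complete x) (∈-listsOfLength xs)

    length-bound : ∀ u xs {v} → Linked _<_ (u ∷ xs ++ v ∷ []) →
                   List.length xs ℕ.+ ρ u ℕ.< ρ v
    length-bound u []       (u<v ∷ _)  = ρ-mono-< u<v
    length-bound u (t ∷ ts) (u<t ∷ ch) = ℕ.≤-<-trans
      (ℕ.≤-trans (ℕ.≤-reflexive (sym (ℕ.+-suc (List.length ts) (ρ u))))
                 (ℕ.+-monoʳ-≤ (List.length ts) (ρ-mono-< u<t)))
      (length-bound t ts ch)

  chains-complete : ∀ {xs} → IsChain xs → xs ∈ chains
  chains-complete {xs} ch = ∈-filter⁺ isChain?
    (∈-concatMap⁺ listsOfLength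
      (Any.map (λ { refl → ∈-listsOfLength xs })
        (∈-upTo⁺ (ℕ.m+n≤o⇒m≤o∸n (ℕ.suc (List.length xs)) (length-bound 0̂ xs ch)))))
    ch

------------------------------------------------------------------------
-- Restriction to a decidable subset; intervals

module _ {A : Set p} {S : Pred A s} (S? : Decidable₁ S) where

  refineAll : List A → List (Refinement A S)
  refineAll []       = []
  refineAll (x ∷ xs) with S? x
  ... | yes Sx = (x , [ Sx ]) ∷ refineAll xs
  ... | no  _  = refineAll xs

  private
    ∈-refineAll⁻ : ∀ xs {r} → r ∈ refineAll xs → value r ∈ xs
    ∈-refineAll⁻ (x ∷ xs) r∈ with S? x
    ∈-refineAll⁻ (x ∷ xs) (here refl) | yes _ = here refl
    ∈-refineAll⁻ (x ∷ xs) (there r∈)  | yes _ = there (∈-refineAll⁻ xs r∈)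
    ∈-refineAll⁻ (x ∷ xs) r∈          | no  _ = there (∈-refineAll⁻ xs r∈)

  refineAll-complete : ∀ xs r → value r ∈ xs → r ∈ refineAll xs
  refineAll-complete (x ∷ xs) (_ , [ Sr ]) v∈ with S? x
  refineAll-complete (x ∷ xs) (_ , [ Sr ]) (here refl) | yes _  = here refl
  refineAll-complete (x ∷ xs) (_ , [ Sr ]) (there v∈)  | yes _  = there (refineAll-complete xs _ v∈)
  refineAll-complete (x ∷ xs) (_ , [ Sr ]) (here refl) | no ¬Sx = ⊥-elim (recompute (no λ ()) (¬Sx Sr))
  refineAll-complete (x ∷ xs) (_ , [ Sr ]) (there v∈)  | no _   = refineAll-complete xs _ v∈

  refineAll-unique : ∀ {xs} → Unique xs → Unique (refineAll xs)
  refineAll-unique {[]}     []          = []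
  refineAll-unique {x ∷ xs} (x∉xs ∷ un) with S? x
  ... | yes _ = All.tabulate (λ { r∈ refl → All.lookup x∉xs (∈-refineAll⁻ xs r∈) refl })
                ∷ refineAll-unique un
  ... | no  _ = refineAll-unique un

module _ {R : CommutativeRing c ℓ} (P : QuasiGradedPoset R p q) where
  open QuasiGradedPoset P
  private module R = CommutativeRing R

  restrict : {S : Pred Carrier s} → Decidable₁ S → QuasiGradedPoset R (p ⊔ s) q
  restrict {S = S} S? = record
    { Carrier           = Refinement Carrier S
    ; _≤_               = λ u v → value u ≤ value v
    ; isDecPartialOrder = record
      { isPartialOrder = record
        { isPreorder = record
          { isEquivalence = isEquivalence
          ; reflexive     = λ { refl → ≤-refl }
          ; trans         = ≤-trans
          }
        ; antisym = λ u≤v v≤u → value-injective (≤-antisym u≤v v≤u)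
        }
      ; _≟_  = Refinement._≟_ _≟_
      ; _≤?_ = λ u v → value u ≤? value v
      }
    ; elements  = refineAll S? elements
    ; unique    = refineAll-unique S? unique
    ; complete  = λ u → refineAll-complete S? elements u (complete (value u))
    ; ρ         = ρ ∘ value
    ; ρ-mono-<  = λ (u≤v , u≢v) → ρ-mono-< (u≤v , u≢v ∘ value-injective)
    ; ζ̄         = λ u v → ζ̄ (value u) (value v)
    ; ζ̄-refl    = λ u → ζ̄-refl (value u)
    ; ζ̄-support = ζ̄-support
    }

  interval : ∀ u v → u < v → BoundedQuasiGradedPoset R (p ⊔ q) q
  interval u v (u≤v , u≢v) = record
    { poset   = restrict {S = λ t → u ≤ t × t ≤ v} (λ t → (u ≤? t) ×-dec (t ≤? v))
    ; 0̂       = u , [ ≤-refl , u≤v ]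
    ; 1̂       = v , [ u≤v , ≤-refl ]
    ; minimum = λ (t , [ u≤t≤v ]) → recompute (u ≤? t) (proj₁ u≤t≤v)
    ; maximum = λ (t , [ u≤t≤v ]) → recompute (t ≤? v) (proj₂ u≤t≤v)
    ; 0̂<1̂     = u≤v , u≢v ∘ cong value
    }

------------------------------------------------------------------------
-- Zippers

record IsZipper {R : CommutativeRing c ℓ} (P : QuasiGradedPoset R p q)
                (x y z : QuasiGradedPoset.Carrier P) : Set (ℓ ⊔ p ⊔ q) where
  open QuasiGradedPoset P
  private module R = CommutativeRing R
  field
    x≢y         : x ≢ y
    x≢z         : x ≢ z
    y≢z         : y ≢ z
    ρx≡ρy       : ρ x ≡ ρ y
    ρy≡ρz+1     : ρ y ≡ ρ z ℕ.+ 1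
    z⋖x         : z ⋖ x
    z⋖y         : z ⋖ y
    z⋖-only-x-y : ∀ t → z ⋖ t → t ≡ x ⊎ t ≡ y
    ζ̄-x≈y       : ∀ v → z < v → ρ x ℕ.< ρ v → ζ̄ x v R.≈ ζ̄ y v
    ζ̄-y≈z       : ∀ v → z < v → ρ x ℕ.< ρ v → ζ̄ y v R.≈ ζ̄ z v
    ζ̄-zx≈1      : ζ̄ z x R.≈ R.1#
    ζ̄-zy≈1      : ζ̄ z y R.≈ R.1#

module Zip {R : CommutativeRing c ℓ} (P : QuasiGradedPoset R p q)
           {x y z : QuasiGradedPoset.Carrier P} (zipper : IsZipper P x y z) where
  open QuasiGradedPoset P
  open IsZipper zipper
  private module R = CommutativeRing R
  open import Algebra.Properties.Group R.+-group using (ε⁻¹≈ε)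

  Kept : Pred Carrier p
  Kept t = t ≢ x × t ≢ y × t ≢ z

  kept? : Decidable₁ Kept
  kept? t = ¬? (t ≟ x) ×-dec ¬? (t ≟ y) ×-dec ¬? (t ≟ z)

  -- (P ∖ {x , y , z}) ∪ {w}
  Carrierᵠ : Set p
  Carrierᵠ = Maybe (Refinement Carrier Kept)

  pattern w = nothing

  infix 4 _≤ᵠ_
  data _≤ᵠ_ : Carrierᵠ → Carrierᵠ → Set (p ⊔ q) where
    inherited : ∀ {u v} → value u ≤ value v → just u ≤ᵠ just v
    below-w   : ∀ {u} → value u < x ⊎ value u < y → just u ≤ᵠ w
    above-w   : ∀ {v} → x < value v ⊎ y < value v → w ≤ᵠ just v
    w-refl    : w ≤ᵠ w
    -- implied by transitivity
    through-w : ∀ {u v} → value u < x ⊎ value u < y → x < value v ⊎ y < value v →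
                just u ≤ᵠ just v

  ρᵠ : Carrierᵠ → ℕ
  ρᵠ (just u) = ρ (value u)
  ρᵠ w        = ρ x

  ζ̄ᵠ : Carrierᵠ → Carrierᵠ → R.Carrier
  ζ̄ᵠ (just u) (just v) = ζ̄ (value u) (value v)
  ζ̄ᵠ (just u) w        = ζ̄ (value u) x R.+ ζ̄ (value u) y R.- ζ̄ (value u) z
  ζ̄ᵠ w        (just v) = ζ̄ x (value v)
  ζ̄ᵠ w        w        = R.1#

  private
    Below Above : Carrier → Set (p ⊔ q)
    Below u = u < x ⊎ u < y
    Above v = x < v ⊎ y < v

    below? : Decidable₁ Below
    below? u = (u <? x) ⊎-dec (u <? y)

    above? : Decidable₁ Above
    above? v = (x <? v) ⊎-dec (y <? v)

    ≤-below : ∀ {u v} → u ≤ v → Below v → Below u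
    ≤-below u≤v (inj₁ v<x) = inj₁ (≤-<-trans u≤v v<x)
    ≤-below u≤v (inj₂ v<y) = inj₂ (≤-<-trans u≤v v<y)

    above-≤ : ∀ {u v} → Above u → u ≤ v → Above v
    above-≤ (inj₁ x<u) u≤v = inj₁ (<-≤-trans x<u u≤v)
    above-≤ (inj₂ y<u) u≤v = inj₂ (<-≤-trans y<u u≤v)

    ρ-below : ∀ {u} → Below u → ρ u ℕ.< ρ x
    ρ-below (inj₁ u<x) = ρ-mono-< u<x
    ρ-below (inj₂ u<y) = ℕ.<-≤-trans (ρ-mono-< u<y) (ℕ.≤-reflexive (sym ρx≡ρy))

    ρ-above : ∀ {v} → Above v → ρ x ℕ.< ρ v
    ρ-above (inj₁ x<v) = ρ-mono-< x<v
    ρ-above (inj₂ y<v) = ℕ.≤-<-trans (ℕ.≤-reflexive ρx≡ρy) (ρ-mono-< y<v)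

    ρ-mono-≤ : ∀ {u v} → u ≤ v → ρ u ℕ.≤ ρ v
    ρ-mono-≤ {u} {v} u≤v with u ≟ v
    ... | yes refl = ℕ.≤-refl
    ... | no  u≢v  = ℕ.<⇒≤ (ρ-mono-< (u≤v , u≢v))

    z<x : z < x
    z<x = proj₁ z⋖x

    z<y : z < y
    z<y = proj₁ z⋖y

    reflᵠ : ∀ {u} → u ≤ᵠ u
    reflᵠ {just _}  = inherited ≤-refl
    reflᵠ {nothing} = w-refl

    transᵠ : ∀ {u v t} → u ≤ᵠ v → v ≤ᵠ t → u ≤ᵠ t
    transᵠ (inherited u≤v)   (inherited v≤t)   = inherited (≤-trans u≤v v≤t)
    transᵠ (inherited u≤v)   (below-w v<)      = below-w (≤-below u≤v v<)
    transᵠ (inherited u≤v)   (through-w v< <t) = through-w (≤-below u≤v v<) <t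
    transᵠ (below-w u<)      (above-w <t)      = through-w u< <t
    transᵠ (below-w u<)      w-refl            = below-w u<
    transᵠ (above-w <v)      (inherited v≤t)   = above-w (above-≤ <v v≤t)
    transᵠ (above-w <v)      (below-w v<)      = w-refl
    transᵠ (above-w <v)      (through-w v< <t) = above-w <t
    transᵠ w-refl            v≤t               = v≤t
    transᵠ (through-w u< <v) (inherited v≤t)   = through-w u< (above-≤ <v v≤t)
    transᵠ (through-w u< <v) (below-w v<)      = below-w u<
    transᵠ (through-w u< <v) (through-w v< <t) = through-w u< <t

    ≤ᵠ⇒≡⊎ρ< : ∀ {u v} → u ≤ᵠ v → u ≡ v ⊎ ρᵠ u ℕ.< ρᵠ v
    ≤ᵠ⇒≡⊎ρ< (inherited {u} {v} u≤v) with value u ≟ value v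
    ... | yes u≡v = inj₁ (cong just (value-injective u≡v))
    ... | no  u≢v = inj₂ (ρ-mono-< (u≤v , u≢v))
    ≤ᵠ⇒≡⊎ρ< (below-w u<)      = inj₂ (ρ-below u<)
    ≤ᵠ⇒≡⊎ρ< (above-w <v)      = inj₂ (ρ-above <v)
    ≤ᵠ⇒≡⊎ρ< w-refl            = inj₁ refl
    ≤ᵠ⇒≡⊎ρ< (through-w u< <v) = inj₂ (ℕ.<-trans (ρ-below u<) (ρ-above <v))

    antisymᵠ : ∀ {u v} → u ≤ᵠ v → v ≤ᵠ u → u ≡ v
    antisymᵠ u≤v v≤u with ≤ᵠ⇒≡⊎ρ< u≤v | ≤ᵠ⇒≡⊎ρ< v≤u
    ... | inj₁ u≡v | _        = u≡v
    ... | inj₂ _   | inj₁ v≡u = sym v≡u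
    ... | inj₂ u<v | inj₂ v<u = contradiction v<u (ℕ.<-asym u<v)

    _≤ᵠ?_ : Decidable _≤ᵠ_
    just u  ≤ᵠ? just v  = map′
      (λ { (inj₁ u≤v) → inherited u≤v ; (inj₂ (u< , <v)) → through-w u< <v })
      (λ { (inherited u≤v) → inj₁ u≤v ; (through-w u< <v) → inj₂ (u< , <v) })
      ((value u ≤? value v) ⊎-dec (below? (value u) ×-dec above? (value v)))
    just u  ≤ᵠ? nothing = map′ below-w (λ { (below-w u<) → u< }) (below? (value u))
    nothing ≤ᵠ? just v  = map′ above-w (λ { (above-w <v) → <v }) (above? (value v))
    nothing ≤ᵠ? nothing = yes w-refl

    ζ̄ᵠ-reflᵠ : ∀ u → ζ̄ᵠ u u R.≈ R.1#
    ζ̄ᵠ-reflᵠ (just u) = ζ̄-refl (value u)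
    ζ̄ᵠ-reflᵠ nothing  = R.refl

    ζ̄ᵠ-supportᵠ : ∀ {u v} → ¬ (u ≤ᵠ v) → ζ̄ᵠ u v R.≈ R.0#
    ζ̄ᵠ-supportᵠ {just u} {just v} u≰v = ζ̄-support (u≰v ∘ inherited)
    ζ̄ᵠ-supportᵠ {just (u , [ k ])} {nothing} u≰w = R.trans
      (R.+-cong (R.+-cong (ζ̄-support u≰x) (ζ̄-support u≰y)) (R.-‿cong (ζ̄-support u≰z)))
      (R.trans (R.+-cong (R.+-identityʳ R.0#) ε⁻¹≈ε) (R.+-identityʳ R.0#))
      where
      kept : Kept u
      kept = recompute (kept? u) k
      u≰x : ¬ (u ≤ x)
      u≰x u≤x = u≰w (below-w (inj₁ (u≤x , proj₁ kept)))
      u≰y : ¬ (u ≤ y)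
      u≰y u≤y = u≰w (below-w (inj₂ (u≤y , proj₁ (proj₂ kept))))
      u≰z : ¬ (u ≤ z)
      u≰z u≤z = u≰x (≤-trans u≤z (proj₁ z<x))
    ζ̄ᵠ-supportᵠ {nothing} {just (v , [ k ])} w≰v = ζ̄-support
      (λ x≤v → w≰v (above-w (inj₁ (x≤v , λ x≡v → proj₁ (recompute (kept? v) k) (sym x≡v)))))
    ζ̄ᵠ-supportᵠ {nothing} {nothing} w≰w = ⊥-elim (w≰w w-refl)

  zipped : QuasiGradedPoset R p (p ⊔ q)
  zipped = record
    { Carrier           = Carrierᵠ
    ; _≤_               = _≤ᵠ_
    ; isDecPartialOrder = record
      { isPartialOrder = record
        { isPreorder = record
          { isEquivalence = isEquivalence
          ; reflexive     = λ { refl → reflᵠ }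
          ; trans         = transᵠ
          }
        ; antisym = antisymᵠ
        }
      ; _≟_  = Maybe.≡-dec (Refinement._≟_ _≟_)
      ; _≤?_ = _≤ᵠ?_
      }
    ; elements  = w ∷ List.map just (refineAll kept? elements)
    ; unique    = All.map⁺ (All.universal (λ _ ()) _)
                  ∷ Unique.map⁺ just-injective (refineAll-unique kept? unique)
    ; complete  = λ { nothing  → here refl
                    ; (just u) → there (∈-map⁺ just
                        (refineAll-complete kept? elements u (complete (value u)))) }
    ; ρ         = ρᵠ
    ; ρ-mono-<  = λ (u≤v , u≢v) → case ≤ᵠ⇒≡⊎ρ< u≤v of λ
                    { (inj₁ u≡v) → contradiction u≡v u≢v ; (inj₂ ρ<) → ρ< }
    ; ζ̄         = ζ̄ᵠ
    ; ζ̄-refl    = ζ̄ᵠ-reflᵠ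
    ; ζ̄-support = ζ̄ᵠ-supportᵠ
    }

-- When z ≢ 0̂, the elements 0̂ and 1̂ survive in Q and bound it.
module BoundedZip {R : CommutativeRing c ℓ} (P : BoundedQuasiGradedPoset R p q)
                  {x y z : BoundedQuasiGradedPoset.Carrier P}
                  (zipper : IsZipper (BoundedQuasiGradedPoset.poset P) x y z)
                  (z≢0̂ : z ≢ BoundedQuasiGradedPoset.0̂ P) where
  open BoundedQuasiGradedPoset P
  open IsZipper zipper
  open Zip poset zipper public

  0̂<z : 0̂ < z
  0̂<z = minimum z , λ 0̂≡z → z≢0̂ (sym 0̂≡z)

  0̂<x : 0̂ < x
  0̂<x = <-≤-trans 0̂<z (proj₁ (proj₁ z⋖x))

  0̂<y : 0̂ < y
  0̂<y = <-≤-trans 0̂<z (proj₁ (proj₁ z⋖y))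

  x<1̂ : x < 1̂
  x<1̂ = maximum x , λ { refl →
    ℕ.<-irrefl (sym ρx≡ρy) (ρ-mono-< (maximum y , λ y≡x → x≢y (sym y≡x))) }

  y<1̂ : y < 1̂
  y<1̂ = maximum y , λ { refl → ℕ.<-irrefl ρx≡ρy (ρ-mono-< (maximum x , x≢y)) }

  z<1̂ : z < 1̂
  z<1̂ = <-≤-trans (proj₁ z⋖x) (maximum x)

  0̂ᵠ 1̂ᵠ : Carrierᵠ
  0̂ᵠ = just (0̂ , [ proj₂ 0̂<x , proj₂ 0̂<y , proj₂ 0̂<z ])
  1̂ᵠ = just (1̂ , [ (λ e → proj₂ x<1̂ (sym e))
                 , (λ e → proj₂ y<1̂ (sym e))
                 , (λ e → proj₂ z<1̂ (sym e)) ])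

  private
    minimumᵠ : Minimum _≤ᵠ_ 0̂ᵠ
    minimumᵠ (just v) = inherited (minimum (value v))
    minimumᵠ nothing  = below-w (inj₁ 0̂<x)

    maximumᵠ : Maximum _≤ᵠ_ 1̂ᵠ
    maximumᵠ (just v) = inherited (maximum (value v))
    maximumᵠ nothing  = above-w (inj₁ x<1̂)

  zippedBounded : BoundedQuasiGradedPoset R p (p ⊔ q)
  zippedBounded = record
    { poset   = zipped
    ; 0̂       = 0̂ᵠ
    ; 1̂       = 1̂ᵠ
    ; minimum = minimumᵠ
    ; maximum = maximumᵠ
    ; 0̂<1̂     = inherited (proj₁ 0̂<1̂) , λ e → proj₂ 0̂<1̂ (cong value (just-injective e))
    }

  0̂ᵠ<w : QuasiGradedPoset._<_ zipped 0̂ᵠ w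
  0̂ᵠ<w = minimumᵠ w , λ ()

{-# OPTIONS --safe #-}

-- Splitting off the first step of a chain gives the recursion
--   Ψ[u,v] = M(u,v) + Σₜ M(u,t) 𝐛 Ψ[t,v],   M(u,v) = ζ̄(u,v) (𝐚 − 𝐛)^(ρ(u,v) − 1),
-- and the zipper conditions are identities between the steps M: for t, u ∉ {x , y , z},
--   M(y,t) = M(x,t),  M(z,t) = (𝐚 − 𝐛) M(x,t),  M(z,x) = M(z,y) = 1,
--   M(w,t) = M(x,t),  M(u,w) = M(u,x) + M(u,y) − M(u,z) (𝐚 − 𝐛).
-- Hence Ψ[y,v] = Ψ[x,v] and Ψ[z,v] = (𝐚 − 𝐛 + 2𝐛) Ψ[x,v], and both formulas, with 0̂
-- replaced by any u and 1̂ by any v outside {x , y , z}, follow by descending induction on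
-- ρ(u), using 𝐝 = (𝐚 − 𝐛) 𝐛 + 𝐛 (𝐚 − 𝐛) + 2𝐛𝐛 and 𝐜 = (𝐚 − 𝐛) + 2𝐛.
-- Subtractions are moved to the other side throughout, so that the induction takes place
-- in a semiring.

module Submission where

open import Defs
open import Level using (Level)
open import Algebra.Bundles using (CommutativeRing; Ring)
open import Algebra.Morphism.Structures using (module RingMorphisms)
open import Data.Bool.Base using (if_then_else_; true; false)
open import Data.Irrelevant using ([_])
open import Data.List.Base as List
  using (List; []; _∷_; _++_; concatMap; cartesianProductWith; filter; upTo)
open import Data.List.Membership.Propositional using (_∈_)
open import Data.List.Membership.Propositional.Properties using (∈-map⁺; ∈-map⁻)
open import Data.List.Membership.Propositional.Properties.WithK using (unique∧set⇒bag)
open import Data.List.Properties using (++-assoc; ++-identityʳ; map-upTo)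
open import Data.List.Relation.Binary.BagAndSetEquality using (∼bag⇒↭)
open import Data.List.Relation.Binary.Permutation.Propositional
  using (_↭_)
import Data.List.Relation.Binary.Permutation.Propositional as Perm
open import Data.List.Relation.Unary.All as All using (All; []; _∷_)
open import Data.List.Relation.Unary.AllPairs using ([]; _∷_)
open import Data.List.Relation.Unary.Any as Any using (here; there; any?; satisfied)
open import Data.List.Relation.Unary.Linked using (Linked; [-]; _∷_)
open import Data.List.Relation.Unary.Unique.Propositional using (Unique)
import Data.List.Relation.Unary.Unique.Propositional.Properties as Unique
open import Data.Maybe.Base using (just)
open import Data.Nat.Base as ℕ using (ℕ; zero; suc; _∸_)
import Data.Nat.Properties as ℕ
open import Data.Product.Base using (_×_; _,_; proj₁; proj₂)
open import Data.Refinement using (Refinement; _,_; value; value-injective)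
open import Data.Sum.Base using (_⊎_; inj₁; inj₂)
open import Function.Base using (_∘_)
open import Function.Bundles using (mk⇔)
open import Relation.Binary.PropositionalEquality as ≡ using (_≡_; _≢_)
open import Relation.Nullary using (¬_; yes; no; does; contradiction)
open import Relation.Nullary.Decidable using (_×-dec_; _⊎-dec_; recompute; dec-false)
open import Relation.Unary using (Pred) renaming (Decidable to Decidable₁)
import Algebra.Solver.CommutativeMonoid as CommutativeMonoidSolver
import Algebra.Properties.AbelianGroup as AbelianGroupProperties
import Algebra.Properties.CommutativeSemigroup as CommutativeSemigroupProperties
import Relation.Binary.Reasoning.Setoid as SetoidReasoning

private
  variable
    c ℓ c′ ℓ′ p q r s : Level

-- The ring of non-commutative polynomials, via formal power series

module NCPolynomialProperties (R : CommutativeRing c ℓ) where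
  open NCPolynomial R
  private module R = CommutativeRing R
  open CommutativeSemigroupProperties R.+-commutativeSemigroup using (interchange)
  open AbelianGroupProperties R.+-abelianGroup using (ε⁻¹≈ε; ⁻¹-∙-comm)
  open SetoidReasoning R.setoid

  -- Non-commutative formal power series. Lists of terms are compared only through their
  -- coefficients, so the ring laws are proved for series by induction on words and pulled back
  -- along `coeff`.
  Series : Set c
  Series = Word → R.Carrier

  infix  4 _≗_
  infixl 7 _⋆_

  _≗_ : Series → Series → Set ℓ
  F ≗ G = ∀ u → F u R.≈ G u

  ∂ : Letter → Series → Series
  ∂ l F u = F (l ∷ u)

  -- The Cauchy product, defined through the Leibniz rule
  -- ∂ l (F ⋆ G) = F [] · ∂ l G + ∂ l F ⋆ G.
  _⋆_ : Series → Series → Series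
  (F ⋆ G) []      = F [] R.* G []
  (F ⋆ G) (l ∷ u) = F [] R.* G (l ∷ u) R.+ (∂ l F ⋆ G) u

  ⋆-cong : ∀ {F F′ G G′} → F ≗ F′ → G ≗ G′ → F ⋆ G ≗ F′ ⋆ G′
  ⋆-cong F≗ G≗ []      = R.*-cong (F≗ []) (G≗ [])
  ⋆-cong F≗ G≗ (l ∷ u) =
    R.+-cong (R.*-cong (F≗ []) (G≗ (l ∷ u))) (⋆-cong (λ v → F≗ (l ∷ v)) G≗ u)

  ⋆-zeroˡ : ∀ G → (λ _ → R.0#) ⋆ G ≗ λ _ → R.0#
  ⋆-zeroˡ G []      = R.zeroˡ _
  ⋆-zeroˡ G (l ∷ u) = R.trans (R.+-cong (R.zeroˡ _) (⋆-zeroˡ G u)) (R.+-identityˡ _)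

  ⋆-zeroʳ : ∀ F → F ⋆ (λ _ → R.0#) ≗ λ _ → R.0#
  ⋆-zeroʳ F []      = R.zeroʳ _
  ⋆-zeroʳ F (l ∷ u) = R.trans (R.+-cong (R.zeroʳ _) (⋆-zeroʳ (∂ l F) u)) (R.+-identityˡ _)

  ⋆-distribʳ : ∀ F G H → (λ u → F u R.+ G u) ⋆ H ≗ λ u → (F ⋆ H) u R.+ (G ⋆ H) u
  ⋆-distribʳ F G H []      = R.distribʳ _ _ _
  ⋆-distribʳ F G H (l ∷ u) = R.trans
    (R.+-cong (R.distribʳ _ _ _) (⋆-distribʳ (∂ l F) (∂ l G) H u)) (interchange _ _ _ _)

  ⋆-distribˡ : ∀ F G H → F ⋆ (λ u → G u R.+ H u) ≗ λ u → (F ⋆ G) u R.+ (F ⋆ H) u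
  ⋆-distribˡ F G H []      = R.distribˡ _ _ _
  ⋆-distribˡ F G H (l ∷ u) = R.trans
    (R.+-cong (R.distribˡ _ _ _) (⋆-distribˡ (∂ l F) G H u)) (interchange _ _ _ _)

  ⋆-scale : ∀ r F G → (λ u → r R.* F u) ⋆ G ≗ λ u → r R.* (F ⋆ G) u
  ⋆-scale r F G []      = R.*-assoc _ _ _
  ⋆-scale r F G (l ∷ u) = R.trans
    (R.+-cong (R.*-assoc _ _ _) (⋆-scale r (∂ l F) G u)) (R.sym (R.distribˡ _ _ _))

  -- Induction on the word. By the Leibniz rule `∂ l (F ⋆ G)` is a scalar multiple of `∂ l G` plus
  -- `∂ l F ⋆ G`, so `⋆-distribʳ` and `⋆-scale` reduce the claim to `∂ l F`.
  ⋆-assoc : ∀ F G H → (F ⋆ G) ⋆ H ≗ F ⋆ (G ⋆ H)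
  ⋆-assoc F G H []      = R.*-assoc _ _ _
  ⋆-assoc F G H (l ∷ u) = begin
    F [] R.* G [] R.* H (l ∷ u) R.+ (∂ l (F ⋆ G) ⋆ H) u
      ≈⟨ R.+-cong (R.*-assoc _ _ _) (⋆-distribʳ (λ v → F [] R.* ∂ l G v) (∂ l F ⋆ G) H u) ⟩
    F [] R.* (G [] R.* H (l ∷ u))
      R.+ (((λ v → F [] R.* ∂ l G v) ⋆ H) u R.+ ((∂ l F ⋆ G) ⋆ H) u)
      ≈⟨ R.+-congˡ (R.+-cong (⋆-scale (F []) (∂ l G) H u) (⋆-assoc (∂ l F) G H u)) ⟩
    F [] R.* (G [] R.* H (l ∷ u))
      R.+ (F [] R.* (∂ l G ⋆ H) u R.+ (∂ l F ⋆ (G ⋆ H)) u)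
      ≈⟨ R.+-assoc _ _ _ ⟨
    F [] R.* (G [] R.* H (l ∷ u)) R.+ F [] R.* (∂ l G ⋆ H) u R.+ (∂ l F ⋆ (G ⋆ H)) u
      ≈⟨ R.+-congʳ (R.distribˡ _ _ _) ⟨
    F [] R.* (G ⋆ H) (l ∷ u) R.+ (∂ l F ⋆ (G ⋆ H)) u ∎

  -- The series of the monomial r·u, written exactly as the summand in `coeff`.
  δ : R.Carrier → Word → Series
  δ r u v = if does (u ≟ᵂ v) then r else R.0#

  δ[]-⋆ : ∀ r G → δ r [] ⋆ G ≗ λ u → r R.* G u
  δ[]-⋆ r G []      = R.refl
  δ[]-⋆ r G (l ∷ u) = R.trans (R.+-congˡ (⋆-zeroˡ G u)) (R.+-identityʳ _)

  ⋆-δ[] : ∀ r F → F ⋆ δ r [] ≗ λ u → F u R.* r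
  ⋆-δ[] r F []      = R.refl
  ⋆-δ[] r F (l ∷ u) = R.trans
    (R.+-cong (R.zeroʳ _) (⋆-δ[] r (∂ l F) u)) (R.+-identityˡ _)

  scale-δ : ∀ r t v → (λ u → r R.* δ t v u) ≗ δ (r R.* t) v
  scale-δ r t v u with does (v ≟ᵂ u)
  ... | true  = R.refl
  ... | false = R.zeroʳ r

  δ-⋆ : ∀ r u t v → δ r u ⋆ δ t v ≗ δ (r R.* t) (u ++ v)
  δ-⋆ r []      t v w       = R.trans (δ[]-⋆ r (δ t v) w) (scale-δ r t v w)
  δ-⋆ r (_ ∷ _) t v []      = R.zeroˡ _
  δ-⋆ r (a ∷ u) t v (a ∷ w) =
    R.trans (R.+-cong (R.zeroˡ _) (δ-⋆ r u t v w)) (R.+-identityˡ _)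
  δ-⋆ r (b ∷ u) t v (b ∷ w) =
    R.trans (R.+-cong (R.zeroˡ _) (δ-⋆ r u t v w)) (R.+-identityˡ _)
  δ-⋆ r (a ∷ u) t v (b ∷ w) =
    R.trans (R.+-cong (R.zeroˡ _) (⋆-zeroˡ (δ t v) w)) (R.+-identityˡ _)
  δ-⋆ r (b ∷ u) t v (a ∷ w) =
    R.trans (R.+-cong (R.zeroˡ _) (⋆-zeroˡ (δ t v) w)) (R.+-identityˡ _)

  coeff-+ : ∀ f g → coeff (f + g) ≗ λ w → coeff f w R.+ coeff g w
  coeff-+ []            g w = R.sym (R.+-identityˡ _)
  coeff-+ ((r , u) ∷ f) g w = R.trans (R.+-congˡ (coeff-+ f g w)) (R.sym (R.+-assoc _ _ _))

  coeff-neg : ∀ f → coeff (- f) ≗ λ w → R.- coeff f w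
  coeff-neg []            w = R.sym ε⁻¹≈ε
  coeff-neg ((r , u) ∷ f) w = R.trans (R.+-cong δ-neg (coeff-neg f w)) (⁻¹-∙-comm _ _)
    where
    δ-neg : δ (R.- r) u w R.≈ R.- δ r u w
    δ-neg with does (u ≟ᵂ w)
    ... | true  = R.refl
    ... | false = R.sym ε⁻¹≈ε

  coeff-monomial-* : ∀ r u g →
    coeff (List.map (λ (t , v) → r R.* t , u ++ v) g) ≗ δ r u ⋆ coeff g
  coeff-monomial-* r u []            w = R.sym (⋆-zeroʳ (δ r u) w)
  coeff-monomial-* r u ((t , v) ∷ g) w = begin
    δ (r R.* t) (u ++ v) w R.+ coeff (List.map _ g) w
      ≈⟨ R.+-cong (R.sym (δ-⋆ r u t v w)) (coeff-monomial-* r u g w) ⟩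
    (δ r u ⋆ δ t v) w R.+ (δ r u ⋆ coeff g) w
      ≈⟨ ⋆-distribˡ (δ r u) (δ t v) (coeff g) w ⟨
    (δ r u ⋆ coeff ((t , v) ∷ g)) w ∎

  -- The bridge between the two products: with it, congruence, associativity and distributivity of
  -- `_*_` follow from the same laws for `_⋆_`.
  coeff-* : ∀ f g → coeff (f * g) ≗ coeff f ⋆ coeff g
  coeff-* []            g w = R.sym (⋆-zeroˡ (coeff g) w)
  coeff-* ((r , u) ∷ f) g w = begin
    coeff (List.map _ g ++ f * g) w
      ≈⟨ coeff-+ (List.map _ g) (f * g) w ⟩
    coeff (List.map _ g) w R.+ coeff (f * g) w
      ≈⟨ R.+-cong (coeff-monomial-* r u g w) (coeff-* f g w) ⟩
    (δ r u ⋆ coeff g) w R.+ (coeff f ⋆ coeff g) w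
      ≈⟨ ⋆-distribʳ (δ r u) (coeff f) (coeff g) w ⟨
    (coeff ((r , u) ∷ f) ⋆ coeff g) w ∎

  coeff-scalar : ∀ r → coeff (scalar r) ≗ δ r []
  coeff-scalar r w = R.+-identityʳ _

  coeff-scalar-* : ∀ r f → coeff (scalar r * f) ≗ λ w → r R.* coeff f w
  coeff-scalar-* r f w = begin
    coeff (scalar r * f) w          ≈⟨ coeff-* (scalar r) f w ⟩
    (coeff (scalar r) ⋆ coeff f) w  ≈⟨ ⋆-cong (coeff-scalar r) (λ _ → R.refl) w ⟩
    (δ r [] ⋆ coeff f) w            ≈⟨ δ[]-⋆ r (coeff f) w ⟩
    r R.* coeff f w                 ∎

  coeff-*-scalar : ∀ f r → coeff (f * scalar r) ≗ λ w → coeff f w R.* r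
  coeff-*-scalar f r w = begin
    coeff (f * scalar r) w          ≈⟨ coeff-* f (scalar r) w ⟩
    (coeff f ⋆ coeff (scalar r)) w  ≈⟨ ⋆-cong (λ _ → R.refl) (coeff-scalar r) w ⟩
    (coeff f ⋆ δ r []) w            ≈⟨ ⋆-δ[] r (coeff f) w ⟩
    coeff f w R.* r                 ∎

  *-cong : ∀ {f f′ g g′} → f ≈ f′ → g ≈ g′ → f * g ≈ f′ * g′
  *-cong {f} {f′} {g} {g′} f≈ g≈ w = begin
    coeff (f * g) w          ≈⟨ coeff-* f g w ⟩
    (coeff f ⋆ coeff g) w    ≈⟨ ⋆-cong f≈ g≈ w ⟩
    (coeff f′ ⋆ coeff g′) w  ≈⟨ coeff-* f′ g′ w ⟨
    coeff (f′ * g′) w        ∎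

  *-assoc : ∀ f g h → (f * g) * h ≈ f * (g * h)
  *-assoc f g h w = begin
    coeff ((f * g) * h) w                ≈⟨ coeff-* (f * g) h w ⟩
    (coeff (f * g) ⋆ coeff h) w          ≈⟨ ⋆-cong (coeff-* f g) (λ _ → R.refl) w ⟩
    ((coeff f ⋆ coeff g) ⋆ coeff h) w    ≈⟨ ⋆-assoc (coeff f) (coeff g) (coeff h) w ⟩
    (coeff f ⋆ (coeff g ⋆ coeff h)) w    ≈⟨ ⋆-cong (λ _ → R.refl) (coeff-* g h) w ⟨
    (coeff f ⋆ coeff (g * h)) w          ≈⟨ coeff-* f (g * h) w ⟨
    coeff (f * (g * h)) w                ∎

  *-distribʳ : ∀ f g h → (g + h) * f ≈ g * f + h * f
  *-distribʳ f g h w = begin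
    coeff ((g + h) * f) w                          ≈⟨ coeff-* (g + h) f w ⟩
    (coeff (g + h) ⋆ coeff f) w                    ≈⟨ ⋆-cong (coeff-+ g h) (λ _ → R.refl) w ⟩
    ((λ v → coeff g v R.+ coeff h v) ⋆ coeff f) w  ≈⟨ ⋆-distribʳ (coeff g) (coeff h) (coeff f) w ⟩
    (coeff g ⋆ coeff f) w R.+ (coeff h ⋆ coeff f) w
      ≈⟨ R.+-cong (coeff-* g f w) (coeff-* h f w) ⟨
    coeff (g * f) w R.+ coeff (h * f) w            ≈⟨ coeff-+ (g * f) (h * f) w ⟨
    coeff (g * f + h * f) w                        ∎

  *-distribˡ : ∀ f g h → f * (g + h) ≈ f * g + f * h
  *-distribˡ f g h w = begin
    coeff (f * (g + h)) w                          ≈⟨ coeff-* f (g + h) w ⟩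
    (coeff f ⋆ coeff (g + h)) w                    ≈⟨ ⋆-cong (λ _ → R.refl) (coeff-+ g h) w ⟩
    (coeff f ⋆ (λ v → coeff g v R.+ coeff h v)) w  ≈⟨ ⋆-distribˡ (coeff f) (coeff g) (coeff h) w ⟩
    (coeff f ⋆ coeff g) w R.+ (coeff f ⋆ coeff h) w
      ≈⟨ R.+-cong (coeff-* f g w) (coeff-* f h w) ⟨
    coeff (f * g) w R.+ coeff (f * h) w            ≈⟨ coeff-+ (f * g) (f * h) w ⟨
    coeff (f * g + f * h) w                        ∎

  +-cong : ∀ {f f′ g g′} → f ≈ f′ → g ≈ g′ → f + g ≈ f′ + g′
  +-cong {f} {f′} {g} {g′} f≈ g≈ w = begin
    coeff (f + g) w             ≈⟨ coeff-+ f g w ⟩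
    coeff f w R.+ coeff g w     ≈⟨ R.+-cong (f≈ w) (g≈ w) ⟩
    coeff f′ w R.+ coeff g′ w   ≈⟨ coeff-+ f′ g′ w ⟨
    coeff (f′ + g′) w           ∎

  +-comm : ∀ f g → f + g ≈ g + f
  +-comm f g w = begin
    coeff (f + g) w             ≈⟨ coeff-+ f g w ⟩
    coeff f w R.+ coeff g w     ≈⟨ R.+-comm _ _ ⟩
    coeff g w R.+ coeff f w     ≈⟨ coeff-+ g f w ⟨
    coeff (g + f) w             ∎

  -‿cong : ∀ {f g} → f ≈ g → - f ≈ - g
  -‿cong {f} {g} f≈g w =
    R.trans (coeff-neg f w) (R.trans (R.-‿cong (f≈g w)) (R.sym (coeff-neg g w)))

  -‿inverseʳ : ∀ f → f - f ≈ []
  -‿inverseʳ f w = begin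
    coeff (f - f) w                ≈⟨ coeff-+ f (- f) w ⟩
    coeff f w R.+ coeff (- f) w    ≈⟨ R.+-congˡ (coeff-neg f w) ⟩
    coeff f w R.- coeff f w        ≈⟨ R.-‿inverseʳ _ ⟩
    R.0#                           ∎

  -‿inverseˡ : ∀ f → - f + f ≈ []
  -‿inverseˡ f w = R.trans (+-comm (- f) f w) (-‿inverseʳ f w)

  polynomialRing : Ring c ℓ
  polynomialRing = record
    { Carrier = Poly
    ; _≈_     = _≈_
    ; _+_     = _+_
    ; _*_     = _*_
    ; -_      = -_
    ; 0#      = []
    ; 1#      = scalar R.1#
    ; isRing  = record
      { +-isAbelianGroup = record
        { isGroup = record
          { isMonoid = record
            { isSemigroup = record
              { isMagma = record
                { isEquivalence = record
                  { refl  = λ _ → R.refl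
                  ; sym   = λ f≈g w → R.sym (f≈g w)
                  ; trans = λ f≈g g≈h w → R.trans (f≈g w) (g≈h w)
                  }
                ; ∙-cong = λ {f} {f′} {g} {g′} → +-cong {f} {f′} {g} {g′}
                }
              ; assoc = λ f g h w → R.reflexive (≡.cong (λ k → coeff k w) (++-assoc f g h))
              }
            ; identity = (λ _ _ → R.refl)
                       , λ f w → R.reflexive (≡.cong (λ k → coeff k w) (++-identityʳ f))
            }
          ; inverse = -‿inverseˡ , -‿inverseʳ
          ; ⁻¹-cong = λ {f} {g} → -‿cong {f} {g}
          }
        ; comm = +-comm
        }
      ; *-cong     = λ {f} {f′} {g} {g′} → *-cong {f} {f′} {g} {g′}
      ; *-assoc    = *-assoc
      ; *-identity =
          (λ f w → R.trans (coeff-scalar-* R.1# f w) (R.*-identityˡ _))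
        , (λ f w → R.trans (coeff-*-scalar f R.1# w) (R.*-identityʳ _))
      ; distrib    = *-distribˡ , *-distribʳ
      }
    }

-- Finite sums in a ring

module ListSum (S : Ring c ℓ) where
  open Ring S
  open CommutativeSemigroupProperties +-commutativeSemigroup using (interchange; x∙yz≈y∙xz)
  open SetoidReasoning setoid

  private
    variable
      A : Set p
      B : Set q

  ∑ : List A → (A → Carrier) → Carrier
  ∑ xs f = List.foldr _+_ 0# (List.map f xs)

  infixr 6 ∑
  syntax ∑ xs (λ x → y) = ∑[ x ∈ xs ] y

  ∑-cong : ∀ (xs : List A) {f g} → (∀ x → f x ≈ g x) → ∑ xs f ≈ ∑ xs g
  ∑-cong []       f≈g = refl
  ∑-cong (x ∷ xs) f≈g = +-cong (f≈g x) (∑-cong xs f≈g)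

  ∑-zero : ∀ (xs : List A) {f} → (∀ x → f x ≈ 0#) → ∑ xs f ≈ 0#
  ∑-zero []       f≈0 = refl
  ∑-zero (x ∷ xs) f≈0 = trans (+-cong (f≈0 x) (∑-zero xs f≈0)) (+-identityˡ 0#)

  ∑-+ : ∀ (xs : List A) f g → ∑ xs (λ x → f x + g x) ≈ ∑ xs f + ∑ xs g
  ∑-+ []       f g = sym (+-identityˡ 0#)
  ∑-+ (x ∷ xs) f g = trans (+-congˡ (∑-+ xs f g)) (interchange _ _ _ _)

  *-∑ : ∀ (xs : List A) s f → s * ∑ xs f ≈ ∑ xs (λ x → s * f x)
  *-∑ []       s f = zeroʳ s
  *-∑ (x ∷ xs) s f = trans (distribˡ s _ _) (+-congˡ (*-∑ xs s f))

  ∑-* : ∀ (xs : List A) f s → ∑ xs f * s ≈ ∑ xs (λ x → f x * s)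
  ∑-* []       f s = zeroˡ s
  ∑-* (x ∷ xs) f s = trans (distribʳ s _ _) (+-congˡ (∑-* xs f s))

  ∑-++ : ∀ (xs ys : List A) f → ∑ (xs ++ ys) f ≈ ∑ xs f + ∑ ys f
  ∑-++ []       ys f = sym (+-identityˡ _)
  ∑-++ (x ∷ xs) ys f = trans (+-congˡ (∑-++ xs ys f)) (sym (+-assoc _ _ _))

  ∑-map : ∀ (g : A → B) xs f → ∑ (List.map g xs) f ≈ ∑ xs (f ∘ g)
  ∑-map g []       f = refl
  ∑-map g (x ∷ xs) f = +-congˡ (∑-map g xs f)

  ∑-concatMap : ∀ (g : A → List B) xs f → ∑ (concatMap g xs) f ≈ ∑[ x ∈ xs ] ∑ (g x) f
  ∑-concatMap g []       f = refl
  ∑-concatMap g (x ∷ xs) f = trans (∑-++ (g x) _ f) (+-congˡ (∑-concatMap g xs f))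

  ∑-cartesianProductWith : ∀ {C : Set r} (_∙_ : A → B → C) xs ys f →
    ∑ (cartesianProductWith _∙_ xs ys) f ≈ ∑[ x ∈ xs ] ∑[ y ∈ ys ] f (x ∙ y)
  ∑-cartesianProductWith _∙_ []       ys f = refl
  ∑-cartesianProductWith _∙_ (x ∷ xs) ys f = trans (∑-++ (List.map (x ∙_) ys) _ f)
    (+-cong (∑-map (x ∙_) ys f) (∑-cartesianProductWith _∙_ xs ys f))

  ∑-swap : ∀ (xs : List A) (ys : List B) (f : A → B → Carrier) →
    ∑[ x ∈ xs ] ∑[ y ∈ ys ] f x y ≈ ∑[ y ∈ ys ] ∑[ x ∈ xs ] f x y
  ∑-swap []       ys f = sym (∑-zero ys λ _ → refl)
  ∑-swap (x ∷ xs) ys f = trans (+-congˡ (∑-swap xs ys f)) (sym (∑-+ ys (f x) _))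

  ∑-↭ : ∀ {xs ys : List A} f → xs ↭ ys → ∑ xs f ≈ ∑ ys f
  ∑-↭ f Perm.refl            = refl
  ∑-↭ f (Perm.prep x xs↭ys)  = +-congˡ (∑-↭ f xs↭ys)
  ∑-↭ f (Perm.swap x y xs↭ys) = trans (+-congˡ (+-congˡ (∑-↭ f xs↭ys))) (x∙yz≈y∙xz _ _ _)
  ∑-↭ f (Perm.trans xs↭ ↭ys) = trans (∑-↭ f xs↭) (∑-↭ f ↭ys)

  -- The summand may change along with the range: a term meaningful only on chains is replaced by a
  -- weight that vanishes off chains.
  ∑-filter : ∀ {P : Pred A p} (P? : Decidable₁ P) xs {f g} →
    (∀ x → P x → f x ≈ g x) → (∀ x → ¬ P x → g x ≈ 0#) → ∑ (filter P? xs) f ≈ ∑ xs g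
  ∑-filter P? []       f≈g g≈0 = refl
  ∑-filter P? (x ∷ xs) f≈g g≈0 with P? x
  ... | yes Px = +-cong (f≈g x Px) (∑-filter P? xs f≈g g≈0)
  ... | no ¬Px = trans (∑-filter P? xs f≈g g≈0)
                       (trans (sym (+-identityˡ _)) (+-congʳ (sym (g≈0 x ¬Px))))

  ∑-refineAll : ∀ {P : Pred A p} (P? : Decidable₁ P) xs {f} →
    (∀ x → ¬ P x → f x ≈ 0#) → ∑ (refineAll P? xs) (f ∘ value) ≈ ∑ xs f
  ∑-refineAll P? []       f≈0 = refl
  ∑-refineAll P? (x ∷ xs) f≈0 with P? x
  ... | yes Px = +-congˡ (∑-refineAll P? xs f≈0)
  ... | no ¬Px = trans (∑-refineAll P? xs f≈0)
                       (trans (sym (+-identityˡ _)) (+-congʳ (sym (f≈0 x ¬Px))))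

-- Weighted chain sums in an R-algebra

-- S is an R-algebra with structure map κ, in which 𝐚 − 𝐛 is interpreted by e
-- and 𝐛 by β.
module IndexIn
  (R : CommutativeRing c ℓ) (S : Ring c′ ℓ′)
  (κ : CommutativeRing.Carrier R → Ring.Carrier S)
  (κ-homo : RingMorphisms.IsRingHomomorphism (CommutativeRing.rawRing R) (Ring.rawRing S) κ)
  (κ-central : ∀ r s → Ring._≈_ S (Ring._*_ S (κ r) s) (Ring._*_ S s (κ r)))
  (e β : Ring.Carrier S)
  where

  private module R = CommutativeRing R
  open Ring S
  open ListSum S
  open RingMorphisms.IsRingHomomorphism κ-homo using ()
    renaming (⟦⟧-cong to κ-cong; +-homo to κ-+; 0#-homo to κ-0; 1#-homo to κ-1)
  open SetoidReasoning setoid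
  open CommutativeMonoidSolver +-commutativeMonoid using (solve; _⊕_; _⊜_)

  power : ℕ → Carrier
  power zero    = 1#
  power (suc n) = e * power n

  *-power : ∀ {s m n} → m ≡ n → s * power m ≡ s * power n
  *-power {s} = ≡.cong (λ k → s * power k)

  power-comm : ∀ n → power n * e ≈ e * power n
  power-comm zero    = trans (*-identityˡ e) (sym (*-identityʳ e))
  power-comm (suc n) = trans (*-assoc _ _ _) (*-congˡ (power-comm n))

  module _ (P : QuasiGradedPoset R p q) where
    open QuasiGradedPoset P renaming (Carrier to ∣P∣)

    -- The factor M(u,v). At u = v the formula would give 1, as truncated subtraction makes the
    -- exponent 0, so this case is set to zero by hand; `ζ̄-support` handles u ≰ v. Sums may
    -- therefore run over all elements instead of over chains.
    step : ∣P∣ → ∣P∣ → Carrier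
    step u v = if does (u ≟ v) then 0# else κ (ζ̄ u v) * power (ρ v ∸ ρ u ∸ 1)

    -- The sum over chains from u to v with at most n steps; the bound makes the recursion
    -- structural.
    pathSum : ℕ → ∣P∣ → ∣P∣ → Carrier
    pathSum zero    u v = 0#
    pathSum (suc n) u v = step u v + (∑[ t ∈ elements ] step u t * β * pathSum n t v)

    -- The index of [u , v], which vanishes unless u < v: a chain from u to v
    -- has at most ρ v steps.
    index : ∣P∣ → ∣P∣ → Carrier
    index u v = pathSum (ρ v) u v

    chainWeight : ∣P∣ → List ∣P∣ → ∣P∣ → Carrier
    chainWeight u []       v = step u v
    chainWeight u (t ∷ ts) v = step u t * β * chainWeight t ts v

  module StepProperties (P : QuasiGradedPoset R p q) where
    open QuasiGradedPoset P renaming (Carrier to ∣P∣)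

    step-≢ : ∀ {u v} → u ≢ v → step P u v ≡ κ (ζ̄ u v) * power (ρ v ∸ ρ u ∸ 1)
    step-≢ {u} {v} u≢v = ≡.cong (if_then _ else _) (dec-false (u ≟ v) u≢v)

    κ-zero : ∀ {r} s → r R.≈ R.0# → κ r * s ≈ 0#
    κ-zero s r≈0 = trans (*-congʳ (trans (κ-cong r≈0) κ-0)) (zeroˡ s)

    step-≮ : ∀ {u v} → ¬ (u < v) → step P u v ≈ 0#
    step-≮ {u} {v} u≮v with u ≟ v
    ... | yes _  = refl
    ... | no u≢v = κ-zero _ (ζ̄-support λ u≤v → u≮v (u≤v , u≢v))

    ρ≤⇒≮ : ∀ {u v} → ρ v ℕ.≤ ρ u → ¬ (u < v)
    ρ≤⇒≮ ρv≤ρu u<v = ℕ.<⇒≱ (ρ-mono-< u<v) ρv≤ρu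

    -- What follows a step from u to t matters only when u < t. This supplies the strict inequality
    -- that each induction on rank needs.
    step-*-cong : ∀ {u t F G} → (u < t → F ≈ G) → step P u t * β * F ≈ step P u t * β * G
    step-*-cong {u} {t} {F} {G} F≈G with u <? t
    ... | yes u<t = *-congˡ (F≈G u<t)
    ... | no  u≮t = trans (vanish F) (sym (vanish G))
      where
      vanish : ∀ H → step P u t * β * H ≈ 0#
      vanish H = trans (*-congʳ (trans (*-congʳ (step-≮ u≮t)) (zeroˡ β))) (zeroˡ H)

    step-*-zero : ∀ {u t F} → (u < t → F ≈ 0#) → step P u t * β * F ≈ 0#
    step-*-zero F≈0 = trans (step-*-cong F≈0) (zeroʳ _)

    step-*-zeroˡ : ∀ {u t} F → ¬ (u < t) → step P u t * β * F ≈ 0#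
    step-*-zeroˡ F u≮t = step-*-zero λ u<t → contradiction u<t u≮t

    <-transitive : ∀ {u t v} → u < t → t < v → u < v
    <-transitive u<t t<v = ≤-<-trans (proj₁ u<t) t<v

    pathSum-≮ : ∀ n {u v} → ¬ (u < v) → pathSum P n u v ≈ 0#
    pathSum-≮ zero    u≮v = refl
    pathSum-≮ (suc n) u≮v = trans
      (+-cong (step-≮ u≮v) (∑-zero elements λ t → step-*-zero λ u<t →
        pathSum-≮ n λ t<v → u≮v (<-transitive u<t t<v)))
      (+-identityˡ 0#)

    pathSum-ρ : ∀ n {u v} → ρ v ℕ.≤ ρ u → pathSum P n u v ≈ 0#
    pathSum-ρ n ρv≤ρu = pathSum-≮ n (ρ≤⇒≮ ρv≤ρu)

    -- Inductions run on n with k ≤ n + ρ u, which bounds the rank left to climb; a step upwards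
    -- lowers that bound by at least one.
    deeper : ∀ n {k u t} → k ℕ.≤ suc n ℕ.+ ρ u → ρ u ℕ.< ρ t → k ℕ.≤ n ℕ.+ ρ t
    deeper n k≤ ρu<ρt = ℕ.≤-trans k≤
      (ℕ.≤-trans (ℕ.≤-reflexive (≡.sym (ℕ.+-suc n _))) (ℕ.+-monoʳ-≤ n ρu<ρt))

    -- Ranks increase strictly, so no chain from u to v has more than ρ v - ρ u steps, and any two
    -- bounds at least that large give the same sum.
    pathSum-stable : ∀ m n {u v} → ρ v ℕ.≤ m ℕ.+ ρ u → ρ v ℕ.≤ n ℕ.+ ρ u →
                     pathSum P m u v ≈ pathSum P n u v
    pathSum-stable zero    n       m≥ n≥ = sym (pathSum-ρ n m≥)
    pathSum-stable (suc m) zero    m≥ n≥ = pathSum-ρ (suc m) n≥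
    pathSum-stable (suc m) (suc n) {u} m≥ n≥ = +-congˡ (∑-cong elements λ t →
      step-*-cong λ u<t → pathSum-stable m n
        (deeper m {u = u} m≥ (ρ-mono-< u<t)) (deeper n {u = u} n≥ (ρ-mono-< u<t)))

    index-rec : ∀ u v →
      index P u v ≈ step P u v + (∑[ t ∈ elements ] step P u t * β * index P t v)
    -- With the bound `suc (ρ v)` the sum unfolds to the right-hand side, whose inner sums carry the
    -- bound `ρ v` of `index`.
    index-rec u v = pathSum-stable (ρ v) (suc (ρ v))
      (ℕ.m≤m+n (ρ v) (ρ u)) (ℕ.m≤n⇒m≤1+n (ℕ.m≤m+n (ρ v) (ρ u)))

    -- The bound ρ v ∸ ρ u is the one used in `chains`.
    pathSum≈index : ∀ u v → pathSum P (ρ v ∸ ρ u) u v ≈ index P u v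
    pathSum≈index u v = pathSum-stable (ρ v ∸ ρ u) (ρ v)
      (ℕ.≤-trans (ℕ.m≤n+m∸n (ρ v) (ρ u)) (ℕ.≤-reflexive (ℕ.+-comm (ρ u) _)))
      (ℕ.m≤m+n (ρ v) (ρ u))

    index-ρ : ∀ {u v} → ρ v ℕ.≤ ρ u → index P u v ≈ 0#
    index-ρ {v = v} = pathSum-ρ (ρ v)

    -- A chain from an element of [u , v] up to v never leaves the interval, so extending the sum to
    -- all of P adds only zero terms.
    pathSum-interval : ∀ {u v} (u<v : u < v) n t →
      let open BoundedQuasiGradedPoset (interval P u v u<v) in
      pathSum poset n t 1̂ ≈ pathSum P n (value t) v
    pathSum-interval u<v zero    t = refl
    pathSum-interval {u} {v} u<v (suc n) t = +-cong (step-interval t 1̂) (begin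
      (∑[ s ∈ I.elements ] step poset t s * β * pathSum poset n s 1̂)
        ≈⟨ ∑-cong I.elements (λ s →
             *-cong (*-congʳ (step-interval t s)) (pathSum-interval u<v n s)) ⟩
      (∑[ s ∈ I.elements ] step P (value t) (value s) * β * pathSum P n (value s) v)
        ≈⟨ ∑-refineAll _ elements outside ⟩
      (∑[ s ∈ elements ] step P (value t) s * β * pathSum P n s v) ∎)
      where
      module I = BoundedQuasiGradedPoset (interval P u v u<v)
      open I using (poset; 1̂)
      step-interval : ∀ t s → step poset t s ≈ step P (value t) (value s)
      step-interval t s with value t ≟ value s
      ... | yes _ = refl
      ... | no  _ = refl
      outside : ∀ s → ¬ (u ≤ s × s ≤ v) → step P (value t) s * β * pathSum P n s v ≈ 0#
      outside s ¬u≤s≤v = step-*-zero λ t<s → pathSum-≮ n λ s<v →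
        ¬u≤s≤v (≤-trans (I.minimum t) (proj₁ t<s) , proj₁ s<v)

  -- Summation over the list of all chains

  module _ (P : BoundedQuasiGradedPoset R p q) where
    open BoundedQuasiGradedPoset P renaming (Carrier to ∣P∣)
    open StepProperties poset

    chainWeight-¬linked : ∀ u xs v → ¬ Linked _<_ (u ∷ xs ++ v ∷ []) →
                          chainWeight poset u xs v ≈ 0#
    chainWeight-¬linked u []       v ¬ch = step-≮ λ u<v → ¬ch (u<v ∷ [-])
    chainWeight-¬linked u (t ∷ ts) v ¬ch =
      step-*-zero λ u<t → chainWeight-¬linked t ts v λ ch → ¬ch (u<t ∷ ch)

    -- A list of i interior elements gives i + 1 steps, so lengths below n correspond to at most n
    -- steps. Grouping the lists by length and removing the first entry reproduces the recursion of
    -- `pathSum`.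
    pathSum-lists : ∀ n u v →
      ∑ (concatMap (listsOfLength P) (upTo n)) (λ xs → chainWeight poset u xs v)
        ≈ pathSum poset n u v
    pathSum-lists n u v = trans (∑-concatMap (listsOfLength P) (upTo n) _) (byLength n u)
      where
      byLength : ∀ n u →
        (∑[ i ∈ upTo n ] ∑[ xs ∈ listsOfLength P i ] chainWeight poset u xs v)
          ≈ pathSum poset n u v
      byLength zero    u = refl
      -- Length 0 contributes only the empty list, hence the single step from u to v; the other
      -- lengths are shifted down by one.
      byLength (suc n) u = +-cong (+-identityʳ _) (begin
        (∑[ i ∈ List.applyUpTo suc n ] ∑[ xs ∈ listsOfLength P i ] chainWeight poset u xs v)
          ≡⟨ ≡.cong (λ is → ∑ is _) (map-upTo suc n) ⟨
        (∑[ i ∈ List.map suc (upTo n) ] ∑[ xs ∈ listsOfLength P i ] chainWeight poset u xs v)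
          ≈⟨ ∑-map suc (upTo n) _ ⟩
        (∑[ i ∈ upTo n ] ∑[ xs ∈ listsOfLength P (suc i) ] chainWeight poset u xs v)
          ≈⟨ ∑-cong (upTo n) (λ i → ∑-cartesianProductWith _∷_ elements (listsOfLength P i) _) ⟩
        (∑[ i ∈ upTo n ] ∑[ t ∈ elements ] ∑[ xs ∈ listsOfLength P i ]
          step poset u t * β * chainWeight poset t xs v)
          ≈⟨ ∑-swap (upTo n) elements _ ⟩
        (∑[ t ∈ elements ] ∑[ i ∈ upTo n ] ∑[ xs ∈ listsOfLength P i ]
          step poset u t * β * chainWeight poset t xs v)
          ≈⟨ ∑-cong elements (λ t → ∑-cong (upTo n) λ i → *-∑ (listsOfLength P i) _ _) ⟨
        (∑[ t ∈ elements ] ∑[ i ∈ upTo n ]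
          step poset u t * β * (∑[ xs ∈ listsOfLength P i ] chainWeight poset t xs v))
          ≈⟨ ∑-cong elements (λ t → *-∑ (upTo n) _ _) ⟨
        (∑[ t ∈ elements ] step poset u t * β *
          (∑[ i ∈ upTo n ] ∑[ xs ∈ listsOfLength P i ] chainWeight poset t xs v))
          ≈⟨ ∑-cong elements (λ t → *-congˡ (byLength n t)) ⟩
        (∑[ t ∈ elements ] step poset u t * β * pathSum poset n t v) ∎)

    ∑-chains : ∀ term →
      (∀ xs → Linked _<_ (0̂ ∷ xs ++ 1̂ ∷ []) → term xs ≈ chainWeight poset 0̂ xs 1̂) →
      ∑ (chains P) term ≈ pathSum poset (ρ 1̂ ∸ ρ 0̂) 0̂ 1̂
    ∑-chains term term≈ = trans
      (∑-filter (isChain? P) (concatMap (listsOfLength P) (upTo (ρ 1̂ ∸ ρ 0̂)))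
        term≈ (λ xs → chainWeight-¬linked 0̂ xs 1̂))
      (pathSum-lists (ρ 1̂ ∸ ρ 0̂) 0̂ 1̂)

  -- Zippers: comparing chain sums in P and Q

  module ZipIndex (P : QuasiGradedPoset R p q) {x y z : QuasiGradedPoset.Carrier P}
                  (zipper : IsZipper P x y z) where
    open QuasiGradedPoset P renaming (Carrier to ∣P∣)
    open IsZipper zipper
    open Zip P zipper
    open StepProperties P
    private
      module Q = QuasiGradedPoset zipped
      module QProperties = StepProperties zipped

      K : Set _
      K = Refinement ∣P∣ Kept

      kept : List K
      kept = refineAll kept? elements

      isKept : (u : K) → Kept (value u)
      isKept (u , [ k ]) = recompute (kept? u) k

    z<x : z < x
    z<x = proj₁ z⋖x

    z<y : z < y
    z<y = proj₁ z⋖y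

    1+ρz≡ρx : suc (ρ z) ≡ ρ x
    1+ρz≡ρx = ≡.trans (ℕ.+-comm 1 (ρ z)) (≡.sym (≡.trans ρx≡ρy ρy≡ρz+1))

    Above : ∣P∣ → Set _
    Above v = x < v ⊎ y < v

    above⇒z< : ∀ {v} → Above v → z < v
    above⇒z< (inj₁ x<v) = <-transitive z<x x<v
    above⇒z< (inj₂ y<v) = <-transitive z<y y<v

    above⇒ρ< : ∀ {v} → Above v → ρ x ℕ.< ρ v
    above⇒ρ< (inj₁ x<v) = ρ-mono-< x<v
    above⇒ρ< (inj₂ y<v) = ℕ.≤-<-trans (ℕ.≤-reflexive ρx≡ρy) (ρ-mono-< y<v)

    -- Refining z < v by an intermediate element ends at a cover of z, hence at x or y.
    z<⇒above : ∀ {v} → v ≢ x → v ≢ y → z < v → Above v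
    z<⇒above {v} = descend (suc (ρ v)) (ℕ.n<1+n _)
      where
      descend : ∀ n {v} → ρ v ℕ.< n → v ≢ x → v ≢ y → z < v → Above v
      descend (suc n) {v} (ℕ.s≤s ρv≤n) v≢x v≢y z<v
        with any? (λ t → (z <? t) ×-dec (t <? v)) elements
      ... | no ¬between with z⋖-only-x-y v
              (z<v , λ t z<t t<v → ¬between (Any.map (λ { ≡.refl → z<t , t<v }) (complete t)))
      ...   | inj₁ v≡x = contradiction v≡x v≢x
      ...   | inj₂ v≡y = contradiction v≡y v≢y
      descend (suc n) {v} (ℕ.s≤s ρv≤n) v≢x v≢y z<v | yes between
        with t , z<t , t<v ← satisfied between | t ≟ x | t ≟ y
      ... | yes ≡.refl | _          = inj₁ t<v
      ... | no _       | yes ≡.refl = inj₂ t<v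
      ... | no t≢x     | no t≢y
        with descend n (ℕ.<-≤-trans (ρ-mono-< t<v) ρv≤n) t≢x t≢y z<t
      ...   | inj₁ x<t = inj₁ (<-transitive x<t t<v)
      ...   | inj₂ y<t = inj₂ (<-transitive y<t t<v)

    above? : Decidable₁ Above
    above? v = (x <? v) ⊎-dec (y <? v)

    -- If v lies above only one of x and y, condition (iii) still applies and, with `ζ̄-support`,
    -- makes both sides zero; so it is enough to split on `Above`.
    step-y : (v : K) → step P y (value v) ≈ step P x (value v)
    step-y v with above? (value v)
    ... | no ¬above = trans (step-≮ (¬above ∘ inj₂)) (sym (step-≮ (¬above ∘ inj₁)))
    ... | yes above = begin
      step P y (value v)
        ≡⟨ step-≢ (λ y≡v → proj₁ (proj₂ (isKept v)) (≡.sym y≡v)) ⟩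
      κ (ζ̄ y (value v)) * power (ρ (value v) ∸ ρ y ∸ 1)
        ≈⟨ *-congʳ (κ-cong (ζ̄-x≈y _ (above⇒z< above) (above⇒ρ< above))) ⟨
      κ (ζ̄ x (value v)) * power (ρ (value v) ∸ ρ y ∸ 1)
        ≡⟨ *-power (≡.cong (λ k → ρ (value v) ∸ k ∸ 1) ρx≡ρy) ⟨
      κ (ζ̄ x (value v)) * power (ρ (value v) ∸ ρ x ∸ 1)
        ≡⟨ step-≢ (λ x≡v → proj₁ (isKept v) (≡.sym x≡v)) ⟨
      step P x (value v) ∎

    ∸-suc : ∀ {m n} → m ℕ.< n → n ∸ m ∸ 1 ≡ n ∸ suc m
    ∸-suc {m} {n} m<n = ≡.trans (ℕ.∸-+-assoc n m 1) (≡.cong (n ∸_) (ℕ.+-comm m 1))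

    -- The rank of z is one below that of x, so the exponent grows by one, and the extra `e` moves
    -- past the central scalar. If v is above neither x nor y, then z < v fails too, by `z<⇒above`.
    step-z : (v : K) → step P z (value v) ≈ e * step P x (value v)
    step-z v with above? (value v)
    ... | no ¬above = trans (step-≮ (¬above ∘ z<⇒above v≢x v≢y))
                            (sym (trans (*-congˡ (step-≮ (¬above ∘ inj₁))) (zeroʳ e)))
      where
      v≢x = proj₁ (isKept v)
      v≢y = proj₁ (proj₂ (isKept v))
    ... | yes above = begin
      step P z (value v)
        ≡⟨ step-≢ (λ z≡v → proj₂ (proj₂ (isKept v)) (≡.sym z≡v)) ⟩
      κ (ζ̄ z (value v)) * power (ρ (value v) ∸ ρ z ∸ 1)
        ≈⟨ *-congʳ (κ-cong (R.trans (ζ̄-x≈y _ z<v ρx<ρv) (ζ̄-y≈z _ z<v ρx<ρv))) ⟨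
      κ (ζ̄ x (value v)) * power (ρ (value v) ∸ ρ z ∸ 1)
        ≡⟨ *-power exponent ⟩
      κ (ζ̄ x (value v)) * (e * power (ρ (value v) ∸ ρ x ∸ 1))
        ≈⟨ *-assoc _ _ _ ⟨
      κ (ζ̄ x (value v)) * e * power (ρ (value v) ∸ ρ x ∸ 1)
        ≈⟨ *-congʳ (κ-central _ e) ⟩
      e * κ (ζ̄ x (value v)) * power (ρ (value v) ∸ ρ x ∸ 1)
        ≈⟨ *-assoc _ _ _ ⟩
      e * (κ (ζ̄ x (value v)) * power (ρ (value v) ∸ ρ x ∸ 1))
        ≡⟨ ≡.cong (e *_) (step-≢ (λ x≡v → proj₁ (isKept v) (≡.sym x≡v))) ⟨
      e * step P x (value v) ∎
      where
      z<v   = above⇒z< above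
      ρx<ρv = above⇒ρ< above
      exponent : ρ (value v) ∸ ρ z ∸ 1 ≡ suc (ρ (value v) ∸ ρ x ∸ 1)
      exponent = ≡.trans (∸-suc (ρ-mono-< z<v))
        (≡.trans (≡.cong (ρ (value v) ∸_) 1+ρz≡ρx)
                 -- Restoring the 1 removed by `∸ 1` is sound because ρ x < ρ v.
                 (≡.sym (ℕ.m+[n∸m]≡n (ℕ.m<n⇒0<n∸m ρx<ρv))))

    step-z-cover : ∀ {t} → z < t → ρ t ≡ ρ x → ζ̄ z t R.≈ R.1# → step P z t ≈ 1#
    step-z-cover {t} z<t ρt≡ρx ζ≈1 = begin
      step P z t                         ≡⟨ step-≢ (proj₂ z<t) ⟩
      κ (ζ̄ z t) * power (ρ t ∸ ρ z ∸ 1)  ≡⟨ *-power exponent ⟩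
      κ (ζ̄ z t) * 1#                     ≈⟨ *-identityʳ _ ⟩
      κ (ζ̄ z t)                          ≈⟨ κ-cong ζ≈1 ⟩
      κ R.1#                             ≈⟨ κ-1 ⟩
      1#                                 ∎
      where
      exponent : ρ t ∸ ρ z ∸ 1 ≡ 0
      exponent = ≡.trans (∸-suc (ρ-mono-< z<t))
        (ℕ.m≤n⇒m∸n≡0 (ℕ.≤-reflexive (≡.trans ρt≡ρx (≡.sym 1+ρz≡ρx))))

    step-zx : step P z x ≈ 1#
    step-zx = step-z-cover z<x ≡.refl ζ̄-zx≈1

    step-zy : step P z y ≈ 1#
    step-zy = step-z-cover z<y (≡.sym ρx≡ρy) ζ̄-zy≈1

    stepᵠ-kept : (u v : K) → step zipped (just u) (just v) ≈ step P (value u) (value v)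
    stepᵠ-kept u v with value u ≟ value v
    ... | yes _ = refl
    ... | no  _ = refl

    stepᵠ-from-w : (v : K) → step zipped w (just v) ≈ step P x (value v)
    stepᵠ-from-w v = reflexive (≡.sym (step-≢ λ x≡v → proj₁ (isKept v) (≡.sym x≡v)))

    -- The three terms of ζ̄(u,w) all carry the exponent belonging to the rank of x; for the term of
    -- z this is one more than in `step P u z`, whence the factor `e`.
    stepᵠ-to-w : (u : K) →
      step zipped (just u) w + step P (value u) z * e ≈ step P (value u) x + step P (value u) y
    stepᵠ-to-w u′ = begin
      κ (ζ̄ u x R.+ ζ̄ u y R.- ζ̄ u z) * E + step P u z * e
        ≈⟨ +-congˡ step-uz ⟩
      κ (ζ̄ u x R.+ ζ̄ u y R.- ζ̄ u z) * E + κ (ζ̄ u z) * E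
        ≈⟨ distribʳ E _ _ ⟨
      (κ (ζ̄ u x R.+ ζ̄ u y R.- ζ̄ u z) + κ (ζ̄ u z)) * E
        ≈⟨ *-congʳ (κ-+ _ _) ⟨
      κ (ζ̄ u x R.+ ζ̄ u y R.- ζ̄ u z R.+ ζ̄ u z) * E
        ≈⟨ *-congʳ (κ-cong cancel) ⟩
      κ (ζ̄ u x R.+ ζ̄ u y) * E
        ≈⟨ *-congʳ (κ-+ _ _) ⟩
      (κ (ζ̄ u x) + κ (ζ̄ u y)) * E
        ≈⟨ distribʳ E _ _ ⟩
      κ (ζ̄ u x) * E + κ (ζ̄ u y) * E
        ≡⟨ ≡.cong₂ _+_ (step-≢ u≢x) step-uy ⟨
      step P u x + step P u y ∎
      where
      u   = value u′
      E   = power (ρ x ∸ ρ u ∸ 1)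
      u≢x = proj₁ (isKept u′)
      u≢y = proj₁ (proj₂ (isKept u′))
      u≢z = proj₂ (proj₂ (isKept u′))
      cancel : ζ̄ u x R.+ ζ̄ u y R.- ζ̄ u z R.+ ζ̄ u z R.≈ ζ̄ u x R.+ ζ̄ u y
      cancel = R.trans (R.+-assoc _ _ _)
                       (R.trans (R.+-congˡ (R.-‿inverseˡ _)) (R.+-identityʳ _))
      step-uy : step P u y ≡ κ (ζ̄ u y) * E
      step-uy = ≡.trans (step-≢ u≢y) (*-power (≡.cong (λ k → k ∸ ρ u ∸ 1) (≡.sym ρx≡ρy)))
      exponent : u < z → ρ x ∸ ρ u ∸ 1 ≡ suc (ρ z ∸ ρ u ∸ 1)
      exponent u<z = ≡.trans (≡.cong (λ k → k ∸ ρ u ∸ 1) (≡.sym 1+ρz≡ρx))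
        (≡.trans (∸-suc (ℕ.m<n⇒m<1+n (ρ-mono-< u<z)))
                 (≡.sym (ℕ.m+[n∸m]≡n (ℕ.m<n⇒0<n∸m (ρ-mono-< u<z)))))
      step-uz : step P u z * e ≈ κ (ζ̄ u z) * E
      step-uz with u <? z
      -- Here the exponents need not match, but ζ̄(u,z) vanishes.
      ... | no  u≮z = trans (trans (*-congʳ (step-≮ u≮z)) (zeroˡ e))
                            (sym (κ-zero E (ζ̄-support λ u≤z → u≮z (u≤z , u≢z))))
      ... | yes u<z = begin
        step P u z * e                             ≡⟨ ≡.cong (_* e) (step-≢ u≢z) ⟩
        κ (ζ̄ u z) * power (ρ z ∸ ρ u ∸ 1) * e      ≈⟨ *-assoc _ _ _ ⟩
        κ (ζ̄ u z) * (power (ρ z ∸ ρ u ∸ 1) * e)    ≈⟨ *-congˡ (power-comm (ρ z ∸ ρ u ∸ 1)) ⟩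
        κ (ζ̄ u z) * (e * power (ρ z ∸ ρ u ∸ 1))    ≡⟨ *-power (exponent u<z) ⟨
        κ (ζ̄ u z) * E ∎

    -- Both lists are free of repetitions and have the same members, hence are permutations of each
    -- other. This splits x, y and z off every sum over P.
    elements↭ : elements ↭ x ∷ y ∷ z ∷ List.map value kept
    elements↭ = ∼bag⇒↭ (unique∧set⇒bag unique
      (  (x≢y ∷ x≢z ∷ avoids λ u → proj₁ (isKept u))
       ∷ (y≢z ∷ avoids λ u → proj₁ (proj₂ (isKept u)))
       ∷ (avoids λ u → proj₂ (proj₂ (isKept u)))
       ∷ Unique.map⁺ value-injective (refineAll-unique kept? unique))
      (mk⇔ (λ _ → classify _) (λ _ → complete _)))
      where
      avoids : ∀ {t} → (∀ u → value u ≢ t) → All (t ≢_) (List.map value kept)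
      avoids ≢t = All.tabulate λ t∈ t≡ →
        let u , _ , u≡ = ∈-map⁻ value t∈ in ≢t u (≡.trans (≡.sym u≡) (≡.sym t≡))
      classify : ∀ t → t ∈ x ∷ y ∷ z ∷ List.map value kept
      classify t with t ≟ x | t ≟ y | t ≟ z
      ... | yes t≡x | _       | _       = here t≡x
      ... | no _    | yes t≡y | _       = there (here t≡y)
      ... | no _    | no _    | yes t≡z = there (there (here t≡z))
      ... | no t≢x  | no t≢y  | no t≢z  = there (there (there
        (∈-map⁺ value (refineAll-complete kept? elements (t , [ t≢x , t≢y , t≢z ]) (complete t)))))

    ∑-elements : ∀ f → ∑ elements f ≈ f x + (f y + (f z + ∑ kept (f ∘ value)))
    ∑-elements f = trans (∑-↭ f elements↭) (+-congˡ (+-congˡ (+-congˡ (∑-map value kept f))))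

    index-split : ∀ u v → index P u v ≈ step P u v + (step P u x * β * index P x v
      + (step P u y * β * index P y v + (step P u z * β * index P z v
      + (∑[ t ∈ kept ] step P u (value t) * β * index P (value t) v))))
    index-split u v = trans (index-rec u v) (+-congˡ (∑-elements _))

    indexᵠ-split : ∀ u v → index zipped u v ≈ step zipped u v +
      (step zipped u w * β * index zipped w v
      + (∑[ t ∈ kept ] step zipped u (just t) * β * index zipped (just t) v))
    indexᵠ-split u v = trans (QProperties.index-rec u v) (+-congˡ (+-congˡ (∑-map just kept _)))

    drop₃ : ∀ {k l m s} → k ≈ 0# → l ≈ 0# → m ≈ 0# → k + (l + (m + s)) ≈ s
    drop₃ {k} {l} {m} {s} k≈0 l≈0 m≈0 = begin
      k + (l + (m + s))     ≈⟨ +-cong k≈0 (+-cong l≈0 (+-congʳ m≈0)) ⟩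
      0# + (0# + (0# + s))  ≈⟨ trans (+-identityˡ _) (trans (+-identityˡ _) (+-identityˡ _)) ⟩
      s                     ∎

    ρz≤ρx : ρ z ℕ.≤ ρ x
    ρz≤ρx = ℕ.<⇒≤ (ρ-mono-< z<x)

    index-top : ∀ {u} v → ρ x ℕ.≤ ρ u →
      index P u v ≈ step P u v + (∑[ t ∈ kept ] step P u (value t) * β * index P (value t) v)
    index-top {u} v ρx≤ρu = trans (index-split u v) (+-congˡ (drop₃
      (step-*-zeroˡ _ (ρ≤⇒≮ ρx≤ρu))
      (step-*-zeroˡ _ (ρ≤⇒≮ (ℕ.≤-trans (ℕ.≤-reflexive (≡.sym ρx≡ρy)) ρx≤ρu)))
      (step-*-zeroˡ _ (ρ≤⇒≮ (ℕ.≤-trans ρz≤ρx ρx≤ρu)))))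

    -- Both recursions run over kept elements only, so `step-y` matches them term by term without
    -- induction.
    index-y : (v : K) → index P y (value v) ≈ index P x (value v)
    index-y v = begin
      index P y (value v)
        ≈⟨ index-top (value v) (ℕ.≤-reflexive ρx≡ρy) ⟩
      step P y (value v) + (∑[ t ∈ kept ] step P y (value t) * β * index P (value t) (value v))
        ≈⟨ +-cong (step-y v) (∑-cong kept λ t → *-congʳ (*-congʳ (step-y t))) ⟩
      step P x (value v) + (∑[ t ∈ kept ] step P x (value t) * β * index P (value t) (value v))
        ≈⟨ index-top (value v) ℕ.≤-refl ⟨
      index P x (value v) ∎

    -- Chains from z that start with x or y contribute `β * index P x v` each; the others are the
    -- chains from x with an extra `e` in the first step.
    index-z : (v : K) → index P z (value v) ≈
      e * index P x (value v) + (β * index P x (value v) + β * index P x (value v))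
    index-z v′ = begin
      index P z v
        ≈⟨ index-split z v ⟩
      step P z v + (step P z x * β * T + (step P z y * β * index P y v
        + (step P z z * β * index P z v + ∑ kept (λ t → step P z (value t) * β * G t))))
        ≈⟨ +-cong (step-z v′) (+-cong (*-congʳ (unit step-zx))
             (+-cong (*-cong (unit step-zy) (index-y v′))
             (+-cong (step-*-zeroˡ _ (ρ≤⇒≮ ℕ.≤-refl)) (∑-cong kept λ t →
               trans (*-congʳ (trans (*-congʳ (step-z t)) (*-assoc _ _ _))) (*-assoc _ _ _))))) ⟩
      e * step P x v + (β * T + (β * T
        + (0# + ∑ kept (λ t → e * (step P x (value t) * β * G t)))))
        ≈⟨ +-congˡ (+-congˡ (+-congˡ (trans (+-identityˡ _) (sym (*-∑ kept e _))))) ⟩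
      e * step P x v + (β * T + (β * T + e * X))
        ≈⟨ solve 3 (λ i j k → i ⊕ (j ⊕ (j ⊕ k)) ⊜ (i ⊕ k) ⊕ (j ⊕ j)) refl
             (e * step P x v) (β * T) (e * X) ⟩
      e * step P x v + e * X + (β * T + β * T)
        ≈⟨ +-congʳ (trans (sym (distribˡ e _ _)) (*-congˡ (sym (index-top v ℕ.≤-refl)))) ⟩
      e * T + (β * T + β * T) ∎
      where
      v = value v′
      T = index P x v
      G : K → Carrier
      G t = index P (value t) v
      X = ∑[ t ∈ kept ] step P x (value t) * β * G t
      unit : ∀ {s} → s ≈ 1# → s * β ≈ β
      unit s≈1 = trans (*-congʳ s≈1) (*-identityˡ β)

    index-z-cover : ∀ {t} → ρ t ≡ ρ x → step P z t ≈ 1# → index P z t ≈ 1#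
    index-z-cover {t} ρt≡ρx step≈1 = trans (index-rec z t) (trans
      (+-cong step≈1 (∑-zero elements λ s → step-*-zero λ z<s → index-ρ
        (ℕ.≤-trans (ℕ.≤-reflexive (≡.trans ρt≡ρx (≡.sym 1+ρz≡ρx))) (ρ-mono-< z<s))))
      (+-identityʳ 1#))

    -- The images of 𝐜 and 𝐝, given that 𝐚 is sent to e + β.
    𝐜ₑ 𝐝ₑ : Carrier
    𝐜ₑ = e + (β + β)
    𝐝ₑ = e * β + β * e + (β * β + β * β)

    -- The first formula is assumed here above the rank of x, where its correction term vanishes
    -- because t is not below z. The hypothesis is discharged inside the induction that proves that
    -- formula.
    indexᵠ-w : (v : K) →
      ((t : K) → ρ x ℕ.< ρ (value t) → index zipped (just t) (just v)
        + index P (value t) z * 𝐝ₑ * index P x (value v) ≈ index P (value t) (value v)) →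
      index zipped w (just v) ≈ index P x (value v)
    indexᵠ-w v′ ih = begin
      index zipped w (just v′)
        ≈⟨ indexᵠ-split w (just v′) ⟩
      step zipped w (just v′) + (step zipped w w * β * index zipped w (just v′)
        + (∑[ t ∈ kept ] step zipped w (just t) * β * index zipped (just t) (just v′)))
        ≈⟨ +-cong (stepᵠ-from-w v′) (trans (+-cong
             (trans (*-congʳ (zeroˡ β)) (zeroˡ _))
             (∑-cong kept λ t → trans (*-congʳ (*-congʳ (stepᵠ-from-w t)))
               (step-*-cong λ x<t → unaffected t (ρ-mono-< x<t))))
             (+-identityˡ _)) ⟩
      step P x v + (∑[ t ∈ kept ] step P x (value t) * β * index P (value t) v)
        ≈⟨ index-top v ℕ.≤-refl ⟨
      index P x v ∎
      where
      v = value v′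
      unaffected : (t : K) → ρ x ℕ.< ρ (value t) →
                   index zipped (just t) (just v′) ≈ index P (value t) v
      unaffected t ρx<ρt = begin
        index zipped (just t) (just v′)
          ≈⟨ +-identityʳ _ ⟨
        index zipped (just t) (just v′) + 0#
          ≈⟨ +-congˡ (trans (*-congʳ (trans (*-congʳ
               (index-ρ (ℕ.≤-trans ρz≤ρx (ℕ.<⇒≤ ρx<ρt)))) (zeroˡ _))) (zeroˡ _)) ⟨
        index zipped (just t) (just v′) + index P (value t) z * 𝐝ₑ * index P x v
          ≈⟨ ih t ρx<ρt ⟩
        index P (value t) v ∎

    index-low : ∀ u {v} → ρ v ℕ.≤ ρ x → index P u v ≈ step P u v +
      (step P u z * β * index P z v + (∑[ t ∈ kept ] step P u (value t) * β * index P (value t) v))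
    index-low u {v} ρv≤ρx = trans (index-split u v) (+-congˡ (begin
      step P u x * β * index P x v + (step P u y * β * index P y v + X)
        ≈⟨ +-cong (step-*-zero λ _ → index-ρ ρv≤ρx)
             (+-congʳ (step-*-zero λ _ → index-ρ (ℕ.≤-trans ρv≤ρx (ℕ.≤-reflexive ρx≡ρy)))) ⟩
      0# + (0# + X)
        ≈⟨ trans (+-identityˡ _) (+-identityˡ _) ⟩
      X ∎))
      where
      X = step P u z * β * index P z v
        + (∑[ t ∈ kept ] step P u (value t) * β * index P (value t) v)

    -- The right factor `s` is carried along so that the recursion has the shape of the correction
    -- terms, with `s` equal to `𝐝ₑ * T` or `𝐜ₑ`.
    index-to-z : ∀ (u : K) s → index P (value u) z * s ≈ step P (value u) z * s
      + (∑[ t ∈ kept ] step P (value u) (value t) * β * (index P (value t) z * s))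
    index-to-z u′ s = begin
      index P u z * s
        ≈⟨ *-congʳ (index-low u ρz≤ρx) ⟩
      (step P u z + (step P u z * β * index P z z
        + (∑[ t ∈ kept ] step P u (value t) * β * index P (value t) z))) * s
        ≈⟨ *-congʳ (+-congˡ (trans
             (+-congʳ (step-*-zero λ _ → index-ρ ℕ.≤-refl)) (+-identityˡ _))) ⟩
      (step P u z + (∑[ t ∈ kept ] step P u (value t) * β * index P (value t) z)) * s
        ≈⟨ distribʳ s _ _ ⟩
      step P u z * s + (∑[ t ∈ kept ] step P u (value t) * β * index P (value t) z) * s
        ≈⟨ +-congˡ (trans (∑-* kept _ s) (∑-cong kept λ t → *-assoc _ _ _)) ⟩
      step P u z * s + (∑[ t ∈ kept ] step P u (value t) * β * (index P (value t) z * s)) ∎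
      where
      u = value u′

    -- Grouped so that, for s = `index P x v`, the bracket after `β` is the right-hand side of
    -- `index-z`, and the leading `e` is the one in `stepᵠ-to-w`.
    𝐝ₑ-* : ∀ s → 𝐝ₑ * s ≈ e * (β * s) + β * (e * s + (β * s + β * s))
    𝐝ₑ-* s = begin
      𝐝ₑ * s
        ≈⟨ trans (distribʳ s _ _) (+-cong (distribʳ s _ _) (distribʳ s _ _)) ⟩
      e * β * s + β * e * s + (β * β * s + β * β * s)
        ≈⟨ +-cong (+-cong (*-assoc _ _ _) (*-assoc _ _ _))
                  (+-cong (*-assoc _ _ _) (*-assoc _ _ _)) ⟩
      e * (β * s) + β * (e * s) + (β * (β * s) + β * (β * s))
        ≈⟨ +-assoc _ _ _ ⟩
      e * (β * s) + (β * (e * s) + (β * (β * s) + β * (β * s)))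
        ≈⟨ +-congˡ (trans (+-congˡ (sym (distribˡ β _ _))) (sym (distribˡ β _ _))) ⟩
      e * (β * s) + β * (e * s + (β * s + β * s)) ∎

    -- The local form of the first formula: chains whose first step enters the zipper, at w in Q and
    -- at x, y or z in P.
    through-zipper : (u v : K) →
      step zipped (just u) w * β * index P x (value v)
        + step P (value u) z * (𝐝ₑ * index P x (value v))
      ≈ step P (value u) x * β * index P x (value v)
        + (step P (value u) y * β * index P y (value v)
        + step P (value u) z * β * index P z (value v))
    through-zipper u′ v′ = begin
      W * β * T + mz * (𝐝ₑ * T)
        ≈⟨ +-cong (*-assoc _ _ _) (trans (*-congˡ
             (trans (𝐝ₑ-* T) (+-congˡ (*-congˡ (sym (index-z v′)))))) (distribˡ mz _ _)) ⟩
      W * (β * T) + (mz * (e * (β * T)) + mz * (β * index P z v))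
        ≈⟨ +-congˡ (+-cong (*-assoc _ _ _) (*-assoc _ _ _)) ⟨
      W * (β * T) + (mz * e * (β * T) + mz * β * index P z v)
        ≈⟨ +-assoc _ _ _ ⟨
      W * (β * T) + mz * e * (β * T) + mz * β * index P z v
        ≈⟨ +-congʳ (trans (sym (distribʳ (β * T) _ _))
             (trans (*-congʳ (stepᵠ-to-w u′)) (distribʳ (β * T) _ _))) ⟩
      mx * (β * T) + my * (β * T) + mz * β * index P z v
        ≈⟨ +-assoc _ _ _ ⟩
      mx * (β * T) + (my * (β * T) + mz * β * index P z v)
        ≈⟨ +-cong (sym (*-assoc _ _ _))
             (+-congʳ (trans (sym (*-assoc _ _ _)) (*-congˡ (sym (index-y v′))))) ⟩
      mx * β * T + (my * β * index P y v + mz * β * index P z v) ∎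
      where
      v = value v′
      T = index P x v
      W = step zipped (just u′) w
      mx = step P (value u′) x
      my = step P (value u′) y
      mz = step P (value u′) z

    -- Expand both sides by the first step. Steps into the zipper balance by `through-zipper`, and
    -- steps to kept elements balance by induction.
    index-zipped : (u v : K) →
      index zipped (just u) (just v) + index P (value u) z * 𝐝ₑ * index P x (value v)
        ≈ index P (value u) (value v)
    index-zipped u v = induct (ρ (value v)) u (ℕ.m≤m+n _ _)
      where
      V = value v
      T = index P x V

      induct : ∀ n (u : K) → ρ V ℕ.≤ n ℕ.+ ρ (value u) →
        index zipped (just u) (just v) + index P (value u) z * 𝐝ₑ * T ≈ index P (value u) V
      induct zero u ρv≤ρu = begin
        index zipped (just u) (just v) + index P (value u) z * 𝐝ₑ * T
          ≈⟨ +-cong (QProperties.index-ρ {just u} {just v} ρv≤ρu) vanishes ⟩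
        0# + 0#
          ≈⟨ +-identityˡ 0# ⟩
        0#
          ≈⟨ index-ρ ρv≤ρu ⟨
        index P (value u) V ∎
        where
        vanishes : index P (value u) z * 𝐝ₑ * T ≈ 0#
        vanishes with value u <? z
        -- Here ρ v ≤ ρ u < ρ z < ρ x, so no chain leads from x to v.
        ... | yes u<z = trans (*-congˡ (index-ρ (ℕ.≤-trans ρv≤ρu
                          (ℕ.≤-trans (ℕ.<⇒≤ (ρ-mono-< u<z)) ρz≤ρx)))) (zeroʳ _)
        ... | no  u≮z = trans (*-congʳ (trans (*-congʳ (pathSum-≮ (ρ z) u≮z)) (zeroˡ _))) (zeroˡ _)
      induct (suc n) u ρv≤ = begin
        index zipped (just u) (just v) + index P U z * 𝐝ₑ * T
          ≈⟨ +-cong (indexᵠ-split (just u) (just v))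
               (trans (*-assoc _ _ _) (index-to-z u (𝐝ₑ * T))) ⟩
        step zipped (just u) (just v) + (W * β * index zipped w (just v)
          + (∑[ t ∈ kept ] step zipped (just u) (just t) * β * index zipped (just t) (just v)))
          + (mz * (𝐝ₑ * T) + (∑[ t ∈ kept ] m t * β * (index P (value t) z * (𝐝ₑ * T))))
          ≈⟨ +-cong (+-cong (stepᵠ-kept u v) (+-cong
               -- The induction hypothesis is used beyond w: from u < w and ρ x < ρ t, t has larger
               -- rank than u.
               (QProperties.step-*-cong {just u} {w} λ u<w → indexᵠ-w v λ t ρx<ρt → induct n t
                 (ℕ.≤-trans (deeper n {u = U} ρv≤ (Q.ρ-mono-< u<w))
                            (ℕ.+-monoʳ-≤ n (ℕ.<⇒≤ ρx<ρt))))
               (∑-cong kept λ t → *-congʳ (*-congʳ (stepᵠ-kept u t)))))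
             (+-congˡ (∑-cong kept λ t → *-congˡ (sym (*-assoc _ _ _)))) ⟩
        step P U V + (W * β * T + ∑ kept F) + (mz * (𝐝ₑ * T) + ∑ kept G)
          ≈⟨ solve 5 (λ i j k l o → (i ⊕ (j ⊕ k)) ⊕ (l ⊕ o) ⊜ i ⊕ ((j ⊕ l) ⊕ (k ⊕ o))) refl
               (step P U V) (W * β * T) (∑ kept F) (mz * (𝐝ₑ * T)) (∑ kept G) ⟩
        step P U V + (W * β * T + mz * (𝐝ₑ * T) + (∑ kept F + ∑ kept G))
          ≈⟨ +-congˡ (+-cong (through-zipper u v) (trans (sym (∑-+ kept F G))
               (∑-cong kept λ t → trans (sym (distribˡ _ _ _)) (step-*-cong λ u<t →
                 induct n t (deeper n {u = U} ρv≤ (ρ-mono-< u<t)))))) ⟩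
        step P U V + (step P U x * β * T + (step P U y * β * index P y V + mz * β * index P z V)
          + (∑[ t ∈ kept ] m t * β * index P (value t) V))
          ≈⟨ +-congˡ (trans (+-assoc _ _ _) (+-congˡ (+-assoc _ _ _))) ⟩
        step P U V + (step P U x * β * T + (step P U y * β * index P y V + (mz * β * index P z V
          + (∑[ t ∈ kept ] m t * β * index P (value t) V))))
          ≈⟨ index-split U V ⟨
        index P U V ∎
        where
        U  = value u
        W  = step zipped (just u) w
        mz = step P U z
        m F G : K → Carrier
        m t = step P U (value t)
        F t = m t * β * index zipped (just t) (just v)
        G t = m t * β * (index P (value t) z * 𝐝ₑ * T)

    -- Chains to x and chains to y may each end with the step from z, whose weight is 1. This yields
    -- `step P u z * β` twice, matching `β + β` in `𝐜ₑ`; the remaining `e` is the correction in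
    -- `stepᵠ-to-w`.
    index-zipped-w : (u : K) →
      index zipped (just u) w + index P (value u) z * 𝐜ₑ
        ≈ index P (value u) x + index P (value u) y
    index-zipped-w u = induct (ρ x) u (ℕ.m≤m+n _ _)
      where
      induct : ∀ n (u : K) → ρ x ℕ.≤ n ℕ.+ ρ (value u) →
        index zipped (just u) w + index P (value u) z * 𝐜ₑ ≈ index P (value u) x + index P (value u) y
      induct zero u ρx≤ρu = +-cong
        (trans (QProperties.index-ρ {just u} {w} ρx≤ρu) (sym (index-ρ ρx≤ρu)))
        (trans (trans (*-congʳ (index-ρ (ℕ.≤-trans ρz≤ρx ρx≤ρu))) (zeroˡ 𝐜ₑ))
               (sym (index-ρ (ℕ.≤-trans (ℕ.≤-reflexive (≡.sym ρx≡ρy)) ρx≤ρu))))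
      induct (suc n) u ρx≤ = begin
        index zipped (just u) w + index P U z * 𝐜ₑ
          ≈⟨ +-cong (indexᵠ-split (just u) w) (index-to-z u 𝐜ₑ) ⟩
        W + (W * β * index zipped w w
          + (∑[ t ∈ kept ] step zipped (just u) (just t) * β * index zipped (just t) w))
          + (mz * 𝐜ₑ + ∑ kept G)
          ≈⟨ +-cong (+-congˡ (trans (+-cong
               (QProperties.step-*-zero {just u} {w} λ _ → QProperties.index-ρ {w} {w} ℕ.≤-refl)
               (∑-cong kept λ t → *-congʳ (*-congʳ (stepᵠ-kept u t)))) (+-identityˡ _)))
               (+-congʳ (trans (distribˡ mz _ _) (+-congˡ (distribˡ mz _ _)))) ⟩
        W + ∑ kept F + (mz * e + (mz * β + mz * β) + ∑ kept G)
          ≈⟨ solve 5 (λ i j k l o → (i ⊕ j) ⊕ ((k ⊕ (l ⊕ l)) ⊕ o)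
                                  ⊜ (i ⊕ k) ⊕ ((l ⊕ l) ⊕ (j ⊕ o))) refl
               W (∑ kept F) (mz * e) (mz * β) (∑ kept G) ⟩
        W + mz * e + (mz * β + mz * β + (∑ kept F + ∑ kept G))
          ≈⟨ +-cong (stepᵠ-to-w u) (+-congˡ (begin
            ∑ kept F + ∑ kept G
              ≈⟨ ∑-+ kept F G ⟨
            (∑[ t ∈ kept ] (F t + G t))
              ≈⟨ ∑-cong kept (λ t → trans (sym (distribˡ _ _ _)) (trans
                   (step-*-cong λ u<t → induct n t (deeper n {u = U} ρx≤ (ρ-mono-< u<t)))
                   (distribˡ _ _ _))) ⟩
            (∑[ t ∈ kept ] (X t + Y t))
              ≈⟨ ∑-+ kept X Y ⟩
            ∑ kept X + ∑ kept Y ∎)) ⟩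
        step P U x + step P U y + (mz * β + mz * β + (∑ kept X + ∑ kept Y))
          ≈⟨ solve 5 (λ i j k l o → (i ⊕ j) ⊕ ((k ⊕ k) ⊕ (l ⊕ o))
                                  ⊜ (i ⊕ (k ⊕ l)) ⊕ (j ⊕ (k ⊕ o))) refl
               (step P U x) (step P U y) (mz * β) (∑ kept X) (∑ kept Y) ⟩
        step P U x + (mz * β + ∑ kept X) + (step P U y + (mz * β + ∑ kept Y))
          ≈⟨ +-cong (unfold ≡.refl step-zx) (unfold (≡.sym ρx≡ρy) step-zy) ⟨
        index P U x + index P U y ∎
        where
        U  = value u
        W  = step zipped (just u) w
        mz = step P U z
        m F G X Y : K → Carrier
        m t = step P U (value t)
        F t = m t * β * index zipped (just t) w
        G t = m t * β * (index P (value t) z * 𝐜ₑ)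
        X t = m t * β * index P (value t) x
        Y t = m t * β * index P (value t) y
        unfold : ∀ {t} → ρ t ≡ ρ x → step P z t ≈ 1# → index P U t ≈
          step P U t + (mz * β + (∑[ s ∈ kept ] m s * β * index P (value s) t))
        unfold ρt≡ρx step≈1 = trans (index-low U (ℕ.≤-reflexive ρt≡ρx))
          (+-congˡ (+-congʳ (trans (*-congˡ (index-z-cover ρt≡ρx step≈1)) (*-identityʳ _))))

-- The 𝐚𝐛-index as a weighted chain sum

module ΨAsIndex (R : CommutativeRing c ℓ) where
  open NCPolynomial R
  open NCPolynomialProperties R
  private
    module R = CommutativeRing R
    module S = Ring polynomialRing

  scalar-isRingHomomorphism : RingMorphisms.IsRingHomomorphism R.rawRing S.rawRing scalar
  scalar-isRingHomomorphism = record
    { isSemiringHomomorphism = record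
      { isNearSemiringHomomorphism = record
        { +-isMonoidHomomorphism = record
          { isMagmaHomomorphism = record
            { isRelHomomorphism = record { cong = λ {r} {s} → scalar-cong {r} {s} }
            ; homo              = scalar-+
            }
          ; ε-homo = scalar-0
          }
        ; *-homo = scalar-*
        }
      ; 1#-homo = λ _ → R.refl
      }
    ; -‿homo = λ _ _ → R.refl
    }
    where
    scalar-cong : ∀ {r s} → r R.≈ s → scalar r ≈ scalar s
    scalar-cong r≈s []      = R.+-congʳ r≈s
    scalar-cong r≈s (_ ∷ _) = R.refl
    scalar-+ : ∀ r s → scalar (r R.+ s) ≈ scalar r + scalar s
    scalar-+ r s []      = R.+-assoc r s R.0#
    scalar-+ r s (_ ∷ _) = R.sym (R.+-identityˡ _)
    scalar-0 : scalar R.0# ≈ []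
    scalar-0 []      = R.+-identityˡ _
    scalar-0 (_ ∷ _) = R.+-identityˡ _
    scalar-* : ∀ r s → scalar (r R.* s) ≈ scalar r * scalar s
    scalar-* r s w = R.refl

  scalar-central : ∀ r f → scalar r * f ≈ f * scalar r
  scalar-central r f w = R.trans (coeff-scalar-* r f w)
    (R.trans (R.*-comm _ _) (R.sym (coeff-*-scalar f r w)))

  open IndexIn R polynomialRing scalar scalar-isRingHomomorphism scalar-central (𝐚 - 𝐛) 𝐛 public

  power≡^ : ∀ n → power n ≡ (𝐚 - 𝐛) ^ n
  power≡^ zero    = ≡.refl
  power≡^ (suc n) = ≡.cong ((𝐚 - 𝐛) *_) (power≡^ n)

  module _ (P : BoundedQuasiGradedPoset R p q) where
    open BoundedQuasiGradedPoset P
    open StepProperties poset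

    step-< : ∀ {u v} → u < v → step poset u v ≡ scalar (ζ̄ u v) * (𝐚 - 𝐛) ^ (ρ v ∸ ρ u ∸ 1)
    step-< {u} {v} (_ , u≢v) =
      ≡.trans (step-≢ u≢v) (≡.cong (scalar (ζ̄ u v) *_) (power≡^ (ρ v ∸ ρ u ∸ 1)))

    -- Consecutive elements of a chain are distinct, so the equality test in `step` always takes its
    -- second branch.
    chainTerm≡chainWeight : ∀ u xs v → Linked _<_ (u ∷ xs ++ v ∷ []) →
                            chainTerm P u xs v ≡ chainWeight poset u xs v
    chainTerm≡chainWeight u []       v (u<v ∷ _)  = ≡.sym (step-< u<v)
    chainTerm≡chainWeight u (t ∷ ts) v (u<t ∷ ch) =
      ≡.cong₂ (λ f g → f * 𝐛 * g) (≡.sym (step-< u<t)) (chainTerm≡chainWeight t ts v ch)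

    Ψ≈pathSum : Ψ P ≈ pathSum poset (ρ 1̂ ∸ ρ 0̂) 0̂ 1̂
    Ψ≈pathSum = ∑-chains P (λ xs → chainTerm P 0̂ xs 1̂)
      (λ xs ch → S.reflexive (chainTerm≡chainWeight 0̂ xs 1̂ ch))

    Ψ≈index : Ψ P ≈ index poset 0̂ 1̂
    Ψ≈index w = R.trans (Ψ≈pathSum w) (pathSum≈index 0̂ 1̂ w)

  Ψ-interval : ∀ (P : QuasiGradedPoset R p q) → let open QuasiGradedPoset P in
    ∀ {u v} (u<v : u < v) → Ψ (interval P u v u<v) ≈ index P u v
  Ψ-interval P {u} {v} u<v w = R.trans (Ψ≈pathSum (interval P u v u<v) w)
    (R.trans (pathSum-interval u<v (ρ v ∸ ρ u) _ w) (pathSum≈index u v w))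
    where
    open QuasiGradedPoset P
    open StepProperties P

-- Identities for 𝐜 and 𝐝, and the return to subtraction

module RingIdentities (S : Ring c ℓ) where
  open Ring S
  open SetoidReasoning setoid

  +≈⇒≈- : ∀ {s t u} → s + t ≈ u → s ≈ u - t
  +≈⇒≈- {s} {t} {u} s+t≈u = begin
    s            ≈⟨ +-identityʳ s ⟨
    s + 0#       ≈⟨ +-congˡ (-‿inverseʳ t) ⟨
    s + (t - t)  ≈⟨ +-assoc s t (- t) ⟨
    s + t - t    ≈⟨ +-congʳ s+t≈u ⟩
    u - t        ∎

  -+≈ : ∀ s t → s - t + t ≈ s
  -+≈ s t = trans (+-assoc s (- t) t) (trans (+-congˡ (-‿inverseˡ t)) (+-identityʳ s))

  𝐜ₑ≈𝐜 : ∀ s t → s - t + (t + t) ≈ s + t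
  𝐜ₑ≈𝐜 s t = trans (sym (+-assoc _ t t)) (+-congʳ (-+≈ s t))

  -- One copy of `t * t` goes to each mixed product and completes `s - t` to `s`.
  𝐝ₑ≈𝐝 : ∀ s t → (s - t) * t + t * (s - t) + (t * t + t * t) ≈ s * t + t * s
  𝐝ₑ≈𝐝 s t = begin
    (s - t) * t + t * (s - t) + (t * t + t * t)
      ≈⟨ interchange _ _ _ _ ⟩
    (s - t) * t + t * t + (t * (s - t) + t * t)
      ≈⟨ +-cong (distribʳ t _ _) (distribˡ t _ _) ⟨
    (s - t + t) * t + t * (s - t + t)
      ≈⟨ +-cong (*-congʳ (-+≈ s t)) (*-congˡ (-+≈ s t)) ⟩
    s * t + t * s ∎
    where open CommutativeSemigroupProperties +-commutativeSemigroup using (interchange)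

  zipped-formula : ∀ {g g′ h h′ f f′ t t′ d d′} → g′ + f′ * d′ * t′ ≈ h′ →
    g ≈ g′ → h ≈ h′ → f ≈ f′ → d′ ≈ d → t ≈ t′ → g ≈ h - f * d * t
  zipped-formula eq g≈ h≈ f≈ d≈ t≈ = +≈⇒≈-
    (trans (+-cong g≈ (*-cong (*-cong f≈ (sym d≈)) t≈)) (trans eq (sym h≈)))

  zipped-w-formula : ∀ {g g′ h h′ k k′ f f′ d d′} → g′ + f′ * d′ ≈ h′ + k′ →
    g ≈ g′ → h ≈ h′ → k ≈ k′ → f ≈ f′ → d′ ≈ d → g ≈ h + k - f * d
  zipped-w-formula eq g≈ h≈ k≈ f≈ d≈ = +≈⇒≈-
    (trans (+-cong g≈ (*-cong f≈ (sym d≈))) (trans eq (sym (+-cong h≈ k≈))))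

proposition5p8 : ∀ {c ℓ p q} (R : CommutativeRing c ℓ) (P : BoundedQuasiGradedPoset R p q) →
    let open NCPolynomial R in
    let open BoundedQuasiGradedPoset P in
    (x y z : Carrier) (zipper : IsZipper poset x y z) (z≢0̂ : z ≢ 0̂) →
    let open BoundedZip P zipper z≢0̂ in
    (Ψ zippedBounded
    ≈ Ψ P - Ψ (interval poset 0̂ z 0̂<z) * 𝐝 * Ψ (interval poset x 1̂ x<1̂))
    ×
    (Ψ (interval zipped 0̂ᵠ w 0̂ᵠ<w)
    ≈ Ψ (interval poset 0̂ x 0̂<x) + Ψ (interval poset 0̂ y 0̂<y)
    - Ψ (interval poset 0̂ z 0̂<z) * 𝐜)
proposition5p8 R P x y z zipper z≢0̂ =
    zipped-formula
      {Ψ zippedBounded} {index zipped 0̂ᵠ 1̂ᵠ} {Ψ P} {index poset 0̂ 1̂}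
      {Ψ (interval poset 0̂ z 0̂<z)} {index poset 0̂ z}
      {Ψ (interval poset x 1̂ x<1̂)} {index poset x 1̂} {𝐝} {𝐝ₑ}
      -- The general formula at u = 0̂ and v = 1̂, both of which lie outside the zipper because z ≢
      -- 0̂ and x, y, z < 1̂.
      (index-zipped (0̂ , [ _ ]) (1̂ , [ _ ]))
      (Ψ≈index zippedBounded) (Ψ≈index P) (Ψ-interval poset 0̂<z)
      (𝐝ₑ≈𝐝 𝐚 𝐛) (Ψ-interval poset x<1̂)
  , zipped-w-formula
      {Ψ (interval zipped 0̂ᵠ w 0̂ᵠ<w)} {index zipped 0̂ᵠ w}
      {Ψ (interval poset 0̂ x 0̂<x)} {index poset 0̂ x}
      {Ψ (interval poset 0̂ y 0̂<y)} {index poset 0̂ y}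
      {Ψ (interval poset 0̂ z 0̂<z)} {index poset 0̂ z} {𝐜} {𝐜ₑ}
      (index-zipped-w (0̂ , [ _ ]))
      (Ψ-interval zipped 0̂ᵠ<w) (Ψ-interval poset 0̂<x) (Ψ-interval poset 0̂<y)
      (Ψ-interval poset 0̂<z) (𝐜ₑ≈𝐜 𝐚 𝐛)
  where
  open NCPolynomial R
  open BoundedQuasiGradedPoset P
  open BoundedZip P zipper z≢0̂
  open ΨAsIndex R
  open ZipIndex poset zipper
  open RingIdentities (NCPolynomialProperties.polynomialRing R)
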